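{- There is a deterministic $\mathsf{CONGEST}$ algorithm that (exactly) solves the minimum vertex cover problem in bipartite graphs in time $O(\mathsf{OPT}\cdot\log \mathsf{OPT})$, where $\mathsf{OPT}$ is the size of a minimum vertex cover of the input (network) graph.
   Context: $\mathsf{CONGEST}$ model: the network is an $n$-node undirected graph $G$, and each node has a unique $O(\log n)$-bit identifier. Computation proceeds in synchronous communication rounds. In each round every node can perform local computations and send one $O(\log n)$-bit message to each of its neighbors. The time complexity is the number of rounds. At the end each node must know its own part of the output. Minimum vertex cover problem: the network graph is itself the input. A vertex cover is a set of nodes containing at least one endpoint of every edge, and the goal is a vertex cover of minimum cardinality. At the end every node must know whether it belongs to the computed vertex cover. The input graph is bipartite, but the nodes do not initially know the bipartition. Convention: a time bound $O(f)$ is understood as at most $C\cdot(f+1)$ rounds for a universal constant $C$ (so that degenerate cases such as $\mathsf{OPT}=1$ are covered). -}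

module Defs where

open import Data.Bool using (Bool; T)
open import Data.Fin using (Fin)
open import Data.Fin.Subset using (Subset; _∈_; ∣_∣)
open import Data.List using (List; []; length)
open import Data.Nat using (ℕ; zero; suc; _+_; _*_; _≤_)
open import Data.Nat.Logarithm using (⌊log₂_⌋)
open import Data.Product using (Σ; ∃; _×_; _,_)
open import Data.Sum using (_⊎_; inj₁; inj₂)
open import Data.Vec using (lookup)
open import Function.Bundles using (_↔_; Inverse)
open import Function.Definitions using (Injective)
open import Relation.Binary.PropositionalEquality using (_≡_; _≢_)
open import Relation.Nullary using (¬_)

record Graph (n : ℕ) : Set where
  field
    adj    : Fin n → Fin n → Bool

  Adj : Fin n → Fin n → Set
  Adj u v = T (adj u v)

  field
    symm   : ∀ {u v} → Adj u v → Adj v u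
    irrefl : ∀ {v} → ¬ Adj v v

  Neighbour : Fin n → Set
  Neighbour v = Σ (Fin n) λ u → Adj v u

open Graph public

Bipartite : ∀ {n} → Graph n → Set
Bipartite {n} G =
  ∃ λ (side : Fin n → Bool) → ∀ {u v} → Adj G u v → side u ≢ side v

IsVertexCover : ∀ {n} → Graph n → Subset n → Set
IsVertexCover G S = ∀ {u v} → Adj G u v → u ∈ S ⊎ v ∈ S

IsMinimumVertexCover : ∀ {n} → Graph n → Subset n → Set
IsMinimumVertexCover G S =
  IsVertexCover G S × (∀ S′ → IsVertexCover G S′ → ∣ S ∣ ≤ ∣ S′ ∣)

Bits : Set
Bits = List Bool

-- k · O(log n) bits; the "+ 1" keeps the budget positive at n = 1.
logBits : ℕ → ℕ → ℕ
logBits k n = k * (⌊log₂ n ⌋ + 1)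

-- The port numbering, an arbitrary enumeration of the neighbours of each node,
-- is how a node addresses its incident edges. Nothing relates it to the
-- identifiers or to the numbering Fin n of the nodes.
record Network (c n : ℕ) : Set where
  field
    graph     : Graph n
    deg       : Fin n → ℕ
    port      : ∀ v → Fin (deg v) ↔ Neighbour graph v
    ident     : Fin n → Bits
    ident-inj : Injective _≡_ _≡_ ident
    ident-len : ∀ v → length (ident v) ≤ logBits c n

open Network public

-- The code run by every node. Initially a node knows only its degree and its
-- identifier (not n, the identifiers of its neighbours, or its side of the
-- bipartition). Local computation is unrestricted. At the end of a round a node
-- either continues in a new state (inj₁) or halts with its irrevocable
-- output bit (inj₂). The empty message also stands for sending nothing.
record Algorithm : Set₁ where
  field
    State   : ℕ → Set
    init    : (d : ℕ) → Bits → State d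
    send    : ∀ {d} → State d → Fin d → Bits
    receive : ∀ {d} → State d → (Fin d → Bits) → State d ⊎ Bool

open Algorithm public

module Execution (A : Algorithm) {c n : ℕ} (N : Network c n) where

  Config : Set
  Config = (v : Fin n) → State A (deg N v) ⊎ Bool

  sent : Config → (v : Fin n) → Fin (deg N v) → Bits
  sent σ v p with σ v
  ... | inj₁ s = send A s p
  ... | inj₂ _ = []

  received : Config → (v : Fin n) → Fin (deg N v) → Bits
  received σ v p =
    let (u , v~u) = Inverse.to (port N v) p
    in  sent σ u (Inverse.from (port N u) (v , symm (graph N) v~u))

  round : Config → Config
  round σ v with σ v
  ... | inj₁ s = receive A s (received σ v)
  ... | inj₂ b = inj₂ b

  after : ℕ → Config
  after zero    v = inj₁ (init A (deg N v) (ident N v))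
  after (suc t)   = round (after t)

MessagesWithin : (A : Algorithm) {c n : ℕ} → Network c n → ℕ → Set
MessagesWithin A N bits = ∀ t v p → length (sent (after t) v p) ≤ bits
  where open Execution A N

-- After t rounds every node has halted, v with the output bit "v ∈ S".
HaltsWith : (A : Algorithm) {c n : ℕ} → Network c n → ℕ → Subset n → Set
HaltsWith A N t S = ∀ v → after t v ≡ inj₂ (lookup S v)
  where open Execution A N

{-# OPTIONS --safe #-}
module Submission where

-- All nodes share a clock, so the algorithm proceeds in stages s = 0, 1, 2, …, each starting
-- from scratch with the guess OPT ≤ 2 ^ s. Flooding for O(2 ^ s) rounds the smallest identifier
-- together with a parity bit elects a leader and yields the bipartition. A matching is then
-- augmented: a layered search of depth j from the free left nodes finds free right nodes
-- ("holes"), and moving the holes backwards, layer by layer, to the free left nodes enlarges the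
-- matching, with no need to keep the paths disjoint. If a matching of size OPT − k admits no
-- augmenting path with at most j right nodes, each of the first j right layers has size at least
-- k, so j k ≤ OPT. Hence depths just above OPT / k for k = OPT, …, 1 suffice; k is rounded to powers of two,
-- and a stage takes O(2 ^ s (s + 1)) rounds.
--
-- Optimality is certified locally by König's theorem: every edge is covered, and every node of
-- the cover has a mate outside the cover. A failed check, or a disagreement on the leader, is
-- flooded for twice the flooding radius. A node that hears of no failure has all nodes of its
-- component within that distance, so a component halts as a whole, or moves on to the next stage.

open import Defs

open import Data.Bool using (Bool; true; false; not; _∧_; _∨_; _xor_; if_then_else_; T)
open import Data.Bool.Properties using (T?; T-irrelevant; ≤-decTotalOrder; ∨-conicalˡ; ∨-conicalʳ; xor-same; not-injective; not-¬) renaming (_≟_ to _≟ᵇ_)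
open import Data.Empty using (⊥; ⊥-elim)
open import Data.Fin using (Fin; zero; suc)
open import Data.Fin.Properties using (all?; any?) renaming (_≟_ to _≟ᶠ_; suc-injective to sucᶠ-injective)
open import Data.Fin.Subset using (Subset; _∈_; _∉_; ∣_∣; inside; outside; ⊤)
open import Data.Fin.Subset.Properties using (_∈?_; ∈⊤; anySubset?; drop-there)
open import Data.List using (List; []; _∷_; _++_; concat; length; replicate; map)
open import Data.List.Properties using (≡-dec; ∷-injectiveˡ; ∷-injectiveʳ; length-++; length-map; length-replicate)
import Data.List.Relation.Binary.Lex.NonStrict as Lex
open import Data.List.Relation.Binary.Pointwise using (Pointwise-≡⇒≡)
open import Data.Maybe using (Maybe; just; nothing; is-just; _<∣>_) renaming (map to mapᴹ)
open import Data.Maybe.Properties using (just-injective) renaming (≡-dec to ≡-decᴹ)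
open import Data.Nat using (ℕ; zero; suc; _+_; _*_; _^_; _≤_; _<_; _≤?_; _<?_; _≡ᵇ_; z≤n; s≤s; s≤s⁻¹) renaming (_≟_ to _≟ⁿ_)
open import Data.Nat.Logarithm using (⌊log₂_⌋; ⌊log₂⌋-mono-≤; ⌊log₂[2^n]⌋≡n)
open import Data.Nat.Properties hiding (≤-decTotalOrder; _≟_; _≤?_; _<?_)
open import Algebra.Properties.CommutativeSemigroup +-commutativeSemigroup using () renaming (interchange to +-interchange)
open import Data.Nat.Solver using (module +-*-Solver)
open import Data.Product using (Σ; ∃; _×_; _,_; proj₁; proj₂)
open import Data.Sum using (_⊎_; inj₁; inj₂; [_,_]′; swap)
open import Data.Unit using (tt) renaming (⊤ to Unit)
open import Data.Vec using (Vec; []; _∷_; here; there; lookup; tabulate)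
open import Data.Vec.Properties using (lookup∘tabulate; tabulate-cong; lookup⇒[]=; []=⇒lookup)
open import Function using (_∘_)
open import Function.Bundles using (Inverse)
open import Level using (0ℓ)
open import Relation.Binary.Bundles using (DecTotalOrder)
open import Relation.Binary.PropositionalEquality using (_≡_; _≢_; refl; sym; trans; cong; cong₂; subst; subst₂)
open import Relation.Nullary using (Dec; yes; no; ¬_; ¬?; _×-dec_; _⊎-dec_; _→-dec_)
open import Relation.Nullary.Decidable using (⌊_⌋; map′; toWitness; fromWitness; dec-true; isYes≗does; decidable-stable)
open import Relation.Unary using (Pred; Decidable)

open +-*-Solver using (solve; _:=_; _:+_; _:*_; con)
open ≤-Reasoning using (begin_; step-≤; step-≡-⟩; step-≡-⟨; step-≡-∣; _∎)

-- Counting and minimum vertex covers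

-- In a stage whose guess is too small, parities, levels and even the pointers between mates may be
-- inconsistent, so the correctness of an output rests on the checks alone. They extract the pointer
-- from the partner to the cover node only: a pointer has one target, so distinct cover nodes get
-- distinct partners without any assumption on the matching. Components may halt in different
-- stages, but neighbours never do; hence a running node never faces a halted one, and every stage
-- can be analysed as if all nodes took part.
--
-- Paths may collide because a lost hole does no harm. If several holes propose to the same left
-- node, it accepts one of them, and in doing so releases its former mate, which is a hole one layer
-- further down, or, at level 1, becomes matched for the first time. Saturated left nodes stay
-- saturated, so a single hole is enough for a phase to gain an edge.
--
-- The logarithm arises from the trade of phases for depth: about `2 ^ a` phases of depth about
-- `2 ^ b` with `a + b = s` cost O(`2 ^ s`) for each of the `s + 1` values of `a`.

indicator : ∀ {A : Set} → Dec A → ℕ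
indicator (yes _) = 1
indicator (no _)  = 0

count : ∀ {n} {P : Pred (Fin n) 0ℓ} → Decidable P → ℕ
count {zero}  P? = 0
count {suc n} P? = indicator (P? zero) + count (P? ∘ suc)

indicator-mono : ∀ {A B : Set} (A? : Dec A) (B? : Dec B) → (A → B) → indicator A? ≤ indicator B?
indicator-mono (no _)  _       _   = z≤n
indicator-mono (yes _) (yes _) _   = ≤-refl
indicator-mono (yes a) (no ¬b) imp = ⊥-elim (¬b (imp a))

count-mono : ∀ {n} {P Q : Pred (Fin n) 0ℓ} (P? : Decidable P) (Q? : Decidable Q) →
             (∀ i → P i → Q i) → count P? ≤ count Q?
count-mono {zero}  P? Q? P⊆Q = z≤n
count-mono {suc n} P? Q? P⊆Q =
  +-mono-≤ (indicator-mono (P? zero) (Q? zero) (P⊆Q zero))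
           (count-mono (P? ∘ suc) (Q? ∘ suc) (P⊆Q ∘ suc))

delete? : ∀ {n} {P : Pred (Fin n) 0ℓ} → Decidable P → (k : Fin n) → Decidable (λ i → P i × i ≢ k)
delete? P? k i = P? i ×-dec ¬? (i ≟ᶠ k)

count-delete : ∀ {n} {P : Pred (Fin n) 0ℓ} (P? : Decidable P) {k} → P k →
               suc (count (delete? P? k)) ≤ count P?
count-delete {suc n} P? {zero} p with P? zero
... | no ¬p = ⊥-elim (¬p p)
... | yes _ = s≤s (count-mono (delete? P? zero ∘ suc) (P? ∘ suc) (λ _ → proj₁))
count-delete {suc n} P? {suc k} p = begin
  suc (indicator (delete? P? (suc k) zero) + count (delete? P? (suc k) ∘ suc))
    ≡⟨ +-suc _ _ ⟨
  indicator (delete? P? (suc k) zero) + suc (count (delete? P? (suc k) ∘ suc))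
    ≤⟨ +-mono-≤ (indicator-mono (delete? P? (suc k) zero) (P? zero) proj₁)
         (s≤s (count-mono (delete? P? (suc k) ∘ suc) (delete? (P? ∘ suc) k)
                (λ _ (q , ≢k) → q , ≢k ∘ cong suc))) ⟩
  indicator (P? zero) + suc (count (delete? (P? ∘ suc) k))
    ≤⟨ +-monoʳ-≤ (indicator (P? zero)) (count-delete (P? ∘ suc) p) ⟩
  indicator (P? zero) + count (P? ∘ suc) ∎

count-mono-< : ∀ {n} {P Q : Pred (Fin n) 0ℓ} (P? : Decidable P) (Q? : Decidable Q) →
               (∀ i → P i → Q i) → ∀ {k} → Q k → ¬ P k → count P? < count Q?
count-mono-< P? Q? P⊆Q {k} q ¬p =
  ≤-trans (s≤s (count-mono P? (delete? Q? k) (λ i p → P⊆Q i p , λ { refl → ¬p p })))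
          (count-delete Q? q)

-- The pigeonhole principle for an injection given as a relation, so that the image may come from a
-- case distinction or an existential. Each step removes the image of one element from `Q`.
count-inj : ∀ {m n} {P : Pred (Fin m) 0ℓ} {Q : Pred (Fin n) 0ℓ} (P? : Decidable P) (Q? : Decidable Q)
            (E : Fin m → Fin n → Set) →
            (∀ i → P i → ∃ λ j → Q j × E i j) →
            (∀ {i i′ j} → E i j → E i′ j → i ≡ i′) →
            count P? ≤ count Q?
count-inj {zero}  P? Q? E image inj = z≤n
count-inj {suc m} P? Q? E image inj with P? zero
... | no _ = count-inj (P? ∘ suc) Q? (E ∘ suc) (λ i → image (suc i))
               (λ e e′ → sucᶠ-injective (inj e e′))
... | yes p with image zero p
... | k , q , e₀ =
  ≤-trans (s≤s (count-inj (P? ∘ suc) (delete? Q? k) (E ∘ suc) image′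
                  (λ e e′ → sucᶠ-injective (inj e e′))))
          (count-delete Q? q)
  where
  image′ : ∀ i → _ → ∃ λ j → (_ × j ≢ k) × E (suc i) j
  image′ i p′ with image (suc i) p′
  ... | j , q′ , e = j , (q′ , λ { refl → 0≢suc (inj e₀ e) }) , e
    where
    0≢suc : zero ≢ suc i
    0≢suc ()

count-∪ : ∀ {n} {P Q R : Pred (Fin n) 0ℓ}
          (P? : Decidable P) (Q? : Decidable Q) (R? : Decidable R) →
          (∀ i → P i → Q i ⊎ R i) → count P? ≤ count Q? + count R?
count-∪ {zero}  P? Q? R? split = z≤n
count-∪ {suc n} P? Q? R? split = begin
  indicator (P? zero) + count (P? ∘ suc)
    ≤⟨ +-mono-≤ (head (P? zero) (Q? zero) (R? zero) (split zero))
                (count-∪ (P? ∘ suc) (Q? ∘ suc) (R? ∘ suc) (split ∘ suc)) ⟩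
  (indicator (Q? zero) + indicator (R? zero)) + (count (Q? ∘ suc) + count (R? ∘ suc))
    ≡⟨ +-interchange (indicator (Q? zero)) _ _ _ ⟩
  count Q? + count R? ∎
  where
  head : ∀ {A B C : Set} (A? : Dec A) (B? : Dec B) (C? : Dec C) → (A → B ⊎ C) →
         indicator A? ≤ indicator B? + indicator C?
  head (no _)  _       _       _ = z≤n
  head (yes _) (yes _) _       _ = s≤s z≤n
  head (yes _) (no _)  (yes _) _ = ≤-refl
  head (yes a) (no ¬b) (no ¬c) f = ⊥-elim ([ ¬b , ¬c ]′ (f a))

count-⊎ : ∀ {n} {P Q R : Pred (Fin n) 0ℓ}
          (P? : Decidable P) (Q? : Decidable Q) (R? : Decidable R) →
          (∀ i → P i → R i) → (∀ i → Q i → R i) → (∀ i → P i → ¬ Q i) →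
          count P? + count Q? ≤ count R?
count-⊎ {zero}  P? Q? R? P⊆R Q⊆R disj = z≤n
count-⊎ {suc n} P? Q? R? P⊆R Q⊆R disj = begin
  (indicator (P? zero) + count (P? ∘ suc)) + (indicator (Q? zero) + count (Q? ∘ suc))
    ≡⟨ +-interchange (indicator (P? zero)) _ _ _ ⟩
  (indicator (P? zero) + indicator (Q? zero)) + (count (P? ∘ suc) + count (Q? ∘ suc))
    ≤⟨ +-mono-≤ (head (P? zero) (Q? zero) (R? zero) (P⊆R zero) (Q⊆R zero) (disj zero))
                (count-⊎ (P? ∘ suc) (Q? ∘ suc) (R? ∘ suc) (P⊆R ∘ suc) (Q⊆R ∘ suc) (disj ∘ suc)) ⟩
  count R? ∎
  where
  head : ∀ {A B C : Set} (A? : Dec A) (B? : Dec B) (C? : Dec C) →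
         (A → C) → (B → C) → (A → ¬ B) → indicator A? + indicator B? ≤ indicator C?
  head (yes a) (yes b) _       _ _ d = ⊥-elim (d a b)
  head (no _)  B?      C?      _ g _ = indicator-mono B? C? g
  head (yes a) (no _)  (yes _) _ _ _ = ≤-refl
  head (yes a) (no _)  (no ¬c) f _ _ = ⊥-elim (¬c (f a))

count-cong : ∀ {n} {P Q : Pred (Fin n) 0ℓ} (P? : Decidable P) (Q? : Decidable Q) →
             (∀ i → P i → Q i) → (∀ i → Q i → P i) → count P? ≡ count Q?
count-cong P? Q? P⊆Q Q⊆P = ≤-antisym (count-mono P? Q? P⊆Q) (count-mono Q? P? Q⊆P)

∣∣≡count : ∀ {n} (S : Subset n) → ∣ S ∣ ≡ count (_∈? S)
∣∣≡count []            = refl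
∣∣≡count (inside  ∷ S) = cong suc (trans (∣∣≡count S)
  (count-cong (_∈? S) (λ i → suc i ∈? (inside ∷ S)) (λ _ → there) (λ _ → drop-there)))
∣∣≡count (outside ∷ S) = trans (∣∣≡count S)
  (count-cong (_∈? S) (λ i → suc i ∈? (outside ∷ S)) (λ _ → there) (λ _ → drop-there))

isVertexCover? : ∀ {n} (G : Graph n) → Decidable (IsVertexCover G)
isVertexCover? G S =
  map′ (λ f {u} {v} → f u v) (λ f u v → f {u} {v})
       (all? λ u → all? λ v → T? (adj G u v) →-dec (u ∈? S ⊎-dec v ∈? S))

-- Serves the analysis only: it fixes OPT, and with it the successful stage, before anything is
-- known to halt. The number `k` is fuel that bounds the size of the current cover.
minimumVertexCover : ∀ {n} (G : Graph n) → ∃ (IsMinimumVertexCover G)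
minimumVertexCover G = search _ ⊤ (λ _ → inj₁ ∈⊤) ≤-refl
  where
  search : ∀ k S → IsVertexCover G S → ∣ S ∣ ≤ k → ∃ (IsMinimumVertexCover G)
  search k S cov ∣S∣≤k with anySubset? (λ S′ → isVertexCover? G S′ ×-dec ∣ S′ ∣ <? ∣ S ∣)
  search k       S cov ∣S∣≤k | no none =
    S , (λ {u} {v} → cov {u} {v}) , λ S′ cov′ → ≮⇒≥ (λ lt → none (S′ , cov′ , lt))
  search zero    S cov ∣S∣≤k | yes (S′ , cov′ , lt) = ⊥-elim (n≮0 (<-≤-trans lt ∣S∣≤k))
  search (suc k) S cov ∣S∣≤k | yes (S′ , cov′ , lt) = search k S′ cov′ (s≤s⁻¹ (≤-trans lt ∣S∣≤k))

-- The algorithm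

open DecTotalOrder (Lex.≤-decTotalOrder ≤-decTotalOrder) using () renaming
  ( _≤_ to _⊑_; _≤?_ to _⊑?_; total to ⊑-total; refl to ⊑-refl; trans to ⊑-trans
  ; antisym to ⊑-antisym′ )

⊑-antisym : ∀ {x y} → x ⊑ y → y ⊑ x → x ≡ y
⊑-antisym p q = Pointwise-≡⇒≡ (⊑-antisym′ p q)

-- right is the parity of the distance to the node named best, which serves as the
-- bipartition once all nodes of a component agree on best. Left nodes of level i and
-- right nodes of level i are those at distance 2i − 2 and 2i − 1 from the free left
-- nodes along alternating paths; level 0 means not reached.
record Local (d : ℕ) : Set where
  field
    best   : Bits
    right  : Bool
    mate   : Maybe (Fin d)
    level  : ℕ
    parent : Maybe (Fin d)
    fail   : Bool

open Local

start : ∀ {d} → Bits → Local d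
start id = record
  { best = id ; right = false ; mate = nothing ; level = 0 ; parent = nothing ; fail = false }

-- König's cover: the unreached left nodes and the reached right nodes.
inCover : ∀ {d} → Local d → Bool
inCover x = right x xor (level x ≡ᵇ 0)

-- Each signal is a round with one bit per edge. Left nodes own the matching: `propose` makes a left
-- node overwrite its mate, and `claim` makes every right node replace its mate by a left node
-- pointing at it, or by nothing. `root` offers nothing and only resets the levels.
data Signal : Set where
  root claim uncovered unmated spread : Signal
  grow reply propose : ℕ → Signal

Offer : Signal → ∀ {d} → Local d → Fin d → Set
Offer root        x p = ⊥
Offer claim       x p = right x ≡ false × mate x ≡ just p
Offer (grow i)    x p = right x ≡ false × level x ≡ i
Offer (reply i)   x p = right x ≡ true × level x ≡ i × mate x ≡ just p
Offer (propose i) x p = right x ≡ true × level x ≡ i × mate x ≡ nothing × parent x ≡ just p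
Offer uncovered   x p = inCover x ≡ false
Offer unmated     x p = inCover x ≡ false × mate x ≡ just p
Offer spread      x p = fail x ≡ true

_≟ᵐ_ : ∀ {d} (m m′ : Maybe (Fin d)) → Dec (m ≡ m′)
_≟ᵐ_ = ≡-decᴹ _≟ᶠ_

offer? : ∀ I {d} (x : Local d) p → Dec (Offer I x p)
offer? root        x p = no λ ()
offer? claim       x p = right x ≟ᵇ false ×-dec mate x ≟ᵐ just p
offer? (grow i)    x p = right x ≟ᵇ false ×-dec level x ≟ⁿ i
offer? (reply i)   x p = right x ≟ᵇ true ×-dec level x ≟ⁿ i ×-dec mate x ≟ᵐ just p
offer? (propose i) x p =
  right x ≟ᵇ true ×-dec level x ≟ⁿ i ×-dec mate x ≟ᵐ nothing ×-dec parent x ≟ᵐ just p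
offer? uncovered   x p = inCover x ≟ᵇ false
offer? unmated     x p = inCover x ≟ᵇ false ×-dec mate x ≟ᵐ just p
offer? spread      x p = fail x ≟ᵇ true

-- A cover node insists that the first `unmated` offer comes from its own mate. In a valid matching
-- nobody else points at it, so looking at the first offer alone causes no false alarm.
confirms : ∀ {d} → Maybe (Fin d) → Maybe (Fin d) → Bool
confirms (just p) (just q) = ⌊ p ≟ᶠ q ⌋
confirms _        _        = false

rootLevel : ∀ {A : Set} → Maybe A → ℕ
rootLevel nothing  = 1
rootLevel (just _) = 0

-- h is the first port, if any, on which an offer arrives.
react : Signal → ∀ {d} → Local d → Maybe (Fin d) → Local d
react root        x h = record x { level = if right x then 0 else rootLevel (mate x) }
react claim       x h = record x { mate = if right x then h else mate x }
react (grow i)    x h = record x { level  = if new then i else level x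
                                 ; parent = if new then h else parent x }
  where new = right x ∧ ((level x ≡ᵇ 0) ∧ is-just h)
react (reply i)   x h =
  record x { level = if not (right x) ∧ ((level x ≡ᵇ 0) ∧ is-just h) then suc i else level x }
react (propose i) x h = record x { mate = if right x then mate x else (h <∣> mate x) }
react uncovered   x h = record x { fail = fail x ∨ (not (inCover x) ∧ is-just h) }
react unmated     x h = record x { fail = fail x ∨ (inCover x ∧ not (confirms (mate x) h)) }
react spread      x h = record x { fail = fail x ∨ is-just h }

isOffer : Bits → Bool
isOffer []      = false
isOffer (b ∷ _) = b

firstOffer : ∀ {d} → Vec Bits d → Maybe (Fin d)
firstOffer []       = nothing
firstOffer (m ∷ ms) = if isOffer m then just zero else mapᴹ suc (firstOffer ms)

data Instr : Set where
  flood agree : Instr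
  signal      : Signal → Instr

improve : ∀ {d} → Bits → Local d → Local d
improve []       x = x
improve (b ∷ id) x = if ⌊ best x ⊑? id ⌋ then x else record x { best = id ; right = not b }

improveAll : ∀ {d k} → Local d → Vec Bits k → Local d
improveAll x []       = x
improveAll x (m ∷ ms) = improve m (improveAll x ms)

consistent? : ∀ {d} (x : Local d) (ms : Vec Bits d) →
              Dec (∀ p → lookup ms p ≡ not (right x) ∷ best x)
consistent? x ms = all? λ p → ≡-dec _≟ᵇ_ (lookup ms p) (not (right x) ∷ best x)

emit : Instr → ∀ {d} → Local d → Fin d → Bits
emit flood      x p = right x ∷ best x
emit agree      x p = right x ∷ best x
emit (signal I) x p = ⌊ offer? I x p ⌋ ∷ []

absorb : Instr → ∀ {d} → Local d → Vec Bits d → Local d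
absorb flood      x ms = improveAll x ms
absorb agree      x ms = record x { fail = not ⌊ consistent? x ms ⌋ }
absorb (signal I) x ms = react I x (firstOffer ms)

search : ℕ → List Signal
search zero    = []
search (suc j) = search j ++ grow (suc j) ∷ reply (suc j) ∷ []

retract : ℕ → List Signal
retract zero    = []
retract (suc j) = propose (suc j) ∷ claim ∷ retract j

phase : ℕ → List Signal
phase j = root ∷ search j ++ retract j

repeat : ℕ → List Signal → List Signal
repeat k is = concat (replicate k is)

-- For the guess opt ≤ 2 ^ (a + b): as long as the matching misses the optimum by at least
-- 2 ^ a, some augmenting path has at most 2 ^ b + 1 right nodes, so 2 ^ a phases of this
-- depth halve a deficiency below 2 ^ (a + 1).
schedule : ℕ → ℕ → List Signal
schedule zero    b = repeat 1 (phase (suc (2 ^ b)))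
schedule (suc a) b = repeat (2 ^ suc a) (phase (suc (2 ^ b))) ++ schedule a (suc b)

-- The rounds after which flooding has crossed every connected component that has
-- a vertex cover of size at most 2 ^ s.
radius : ℕ → ℕ
radius s = 2 * suc (2 ^ s)

-- The closing search leaves the levels from which `inCover` reads the cover. Its depth exceeds the
-- number of nonempty right layers when the guess is right, so it is exhaustive.
matching : ℕ → List Signal
matching s = schedule s 0 ++ root ∷ search (suc (2 ^ s))

verify : List Signal
verify = uncovered ∷ unmated ∷ []

stage : ℕ → List Instr
stage s = replicate (radius s) flood ++ agree ∷
          map signal (matching s ++ verify ++ replicate (2 * radius s) spread)

record Running (d : ℕ) : Set where
  constructor running
  field
    name  : Bits
    index : ℕ
    todo  : List Instr
    local : Local d

begin-stage : ∀ {d} → Bits → ℕ → Running d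
begin-stage id s = running id s (stage s) (start id)

-- The end of a stage is tested in the round of its last instruction, so a stage takes exactly as
-- many rounds as it has instructions.
finish : ∀ {d} → Bits → ℕ → List Instr → Local d → Running d ⊎ Bool
finish id s (I ∷ is) x = inj₁ (running id s (I ∷ is) x)
finish id s []       x = if fail x then inj₁ (begin-stage id (suc s)) else inj₂ (inCover x)

emitNow : ∀ {d} → Running d → Fin d → Bits
emitNow (running id s []       x) p = []
emitNow (running id s (I ∷ is) x) p = emit I x p

absorbNow : ∀ {d} → Running d → Vec Bits d → Running d ⊎ Bool
absorbNow (running id s []       x) ms = finish id s [] x
absorbNow (running id s (I ∷ is) x) ms = finish id s is (absorb I x ms)

algorithm : Algorithm
algorithm = record
  { State   = Running
  ; init    = λ d id → begin-stage id 0
  ; send    = emitNow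
  ; receive = λ x f → absorbNow x (tabulate f)
  }

-- Message size

Short : ℕ → ∀ {d} → Running d → Set
Short L r = length (Running.name r) ≤ L × length (best (Running.local r)) ≤ L

improve-short : ∀ {L d} m (x : Local d) → length m ≤ suc L → length (best x) ≤ L →
                length (best (improve m x)) ≤ L
improve-short []       x _  lx = lx
improve-short (b ∷ id) x lm lx with best x ⊑? id
... | yes _ = lx
... | no _  = s≤s⁻¹ lm

flood-short : ∀ {L d k} (ms : Vec Bits k) (x : Local d) → (∀ p → length (lookup ms p) ≤ suc L) →
              length (best x) ≤ L → length (best (improveAll x ms)) ≤ L
flood-short []       x lm lx = lx
flood-short (m ∷ ms) x lm lx =
  improve-short m (improveAll x ms) (lm zero) (flood-short ms x (lm ∘ suc) lx)

react-best : ∀ I {d} (x : Local d) h → best (react I x h) ≡ best x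
react-best root        x h = refl
react-best claim       x h = refl
react-best (grow i)    x h = refl
react-best (reply i)   x h = refl
react-best (propose i) x h = refl
react-best uncovered   x h = refl
react-best unmated     x h = refl
react-best spread      x h = refl

absorb-short : ∀ {L} I {d} (x : Local d) ms → (∀ p → length (lookup ms p) ≤ suc L) →
               length (best x) ≤ L → length (best (absorb I x ms)) ≤ L
absorb-short flood      x ms lm lx = flood-short ms x lm lx
absorb-short agree      x ms lm lx = lx
absorb-short (signal I) x ms lm lx = subst (λ b → length b ≤ _) (sym (react-best I x _)) lx

emitNow-short : ∀ {L d} (r : Running d) p → Short L r → length (emitNow r p) ≤ suc L
emitNow-short (running _ _ []              x) p _       = z≤n
emitNow-short (running _ _ (flood    ∷ is) x) p (_ , l) = s≤s l
emitNow-short (running _ _ (agree    ∷ is) x) p (_ , l) = s≤s l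
emitNow-short (running _ _ (signal _ ∷ is) x) p _       = s≤s z≤n

OnRunning : ∀ {d} → (Running d → Set) → Running d ⊎ Bool → Set
OnRunning P (inj₁ r) = P r
OnRunning P (inj₂ _) = Unit

finish-short : ∀ {L d} id s is (x : Local d) → length id ≤ L → length (best x) ≤ L →
               OnRunning (Short L) (finish id s is x)
finish-short id s (I ∷ is) x l l′ = l , l′
finish-short id s []       x l l′ with fail x
... | true  = l , l
... | false = tt

absorbNow-short : ∀ {L d} (r : Running d) ms → (∀ p → length (lookup ms p) ≤ suc L) → Short L r →
                  OnRunning (Short L) (absorbNow r ms)
absorbNow-short (running id s []       x) ms lm (l , l′) = finish-short id s [] x l l′
absorbNow-short (running id s (I ∷ is) x) ms lm (l , l′) =
  finish-short id s is (absorb I x ms) l (absorb-short I x ms lm l′)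

module _ {c n : ℕ} (N : Network c n) where
  open Execution algorithm N

  after-short : ∀ t v → OnRunning (Short (logBits c n)) (after t v)
  sent-short  : ∀ t v p → length (sent (after t) v p) ≤ suc (logBits c n)

  after-short zero    v = ident-len N v , ident-len N v
  after-short (suc t) v with after t v | after-short t v
  ... | inj₁ r | short = absorbNow-short r _
        (λ p → subst (λ m → length m ≤ _) (sym (lookup∘tabulate (received (after t) v) p))
                     (sent-short t _ _))
        short
  ... | inj₂ b | _     = tt

  sent-short t v p with after t v | after-short t v
  ... | inj₁ r | short = emitNow-short r p short
  ... | inj₂ b | _     = z≤n

  -- The longest messages are an identifier and one parity bit; raising the factor from `c` to
  -- `suc c` pays for that bit even when the logarithm is 0.
  messages-short : MessagesWithin algorithm N (logBits (suc c) n)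
  messages-short t v p = ≤-trans (sent-short t v p)
    (+-monoˡ-≤ (logBits c n) (m≤n+m 1 ⌊log₂ n ⌋))

-- Leader election and consistent failure

isOffer-tabulate : ∀ {d} (f : Fin d → Bool) p → isOffer (lookup (tabulate (λ q → f q ∷ [])) p) ≡ f p
isOffer-tabulate f p = cong isOffer (lookup∘tabulate (λ q → f q ∷ []) p)

firstOffer-just : ∀ {d} (ms : Vec Bits d) {p} → firstOffer ms ≡ just p → isOffer (lookup ms p) ≡ true
firstOffer-just (m ∷ ms) eq with isOffer m in om
firstOffer-just (m ∷ ms) refl | true  = om
firstOffer-just (m ∷ ms) eq   | false with firstOffer ms in rest
firstOffer-just (m ∷ ms) refl | false | just p = firstOffer-just ms rest

firstOffer-nothing : ∀ {d} (ms : Vec Bits d) → firstOffer ms ≡ nothing →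
                     ∀ p → isOffer (lookup ms p) ≡ false
firstOffer-nothing (m ∷ ms) eq p with isOffer m in om
firstOffer-nothing (m ∷ ms) eq zero    | false = om
firstOffer-nothing (m ∷ ms) eq (suc p) | false with firstOffer ms in rest
... | nothing = firstOffer-nothing ms rest p

react-quiet : ∀ I {d} (x : Local d) h → fail (react I x h) ≡ false → fail x ≡ false
react-quiet root        x h q = q
react-quiet claim       x h q = q
react-quiet (grow i)    x h q = q
react-quiet (reply i)   x h q = q
react-quiet (propose i) x h q = q
react-quiet uncovered   x h q = ∨-conicalˡ (fail x) _ q
react-quiet unmated     x h q = ∨-conicalˡ (fail x) _ q
react-quiet spread      x h q = ∨-conicalˡ (fail x) _ q

improve-below : ∀ {d} m (x : Local d) → best (improve m x) ⊑ best x
improve-below []       x = ⊑-refl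
improve-below (b ∷ id) x with best x ⊑? id
... | yes _ = ⊑-refl
... | no ¬p with ⊑-total (best x) id
...   | inj₁ p = ⊥-elim (¬p p)
...   | inj₂ q = q

improve-below-message : ∀ {d} b id (x : Local d) → best (improve (b ∷ id) x) ⊑ id
improve-below-message b id x with best x ⊑? id
... | yes p = p
... | no _  = ⊑-refl

improveAll-below : ∀ {d k} (x : Local d) (ms : Vec Bits k) → best (improveAll x ms) ⊑ best x
improveAll-below x []       = ⊑-refl
improveAll-below x (m ∷ ms) = ⊑-trans (improve-below m (improveAll x ms)) (improveAll-below x ms)

improveAll-below-message : ∀ {d k} (x : Local d) (ms : Vec Bits k) p {b id} → lookup ms p ≡ b ∷ id →
                           best (improveAll x ms) ⊑ id
improveAll-below-message x (m ∷ ms) zero    refl = improve-below-message _ _ (improveAll x ms)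
improveAll-below-message x (m ∷ ms) (suc p) eq   =
  ⊑-trans (improve-below m (improveAll x ms)) (improveAll-below-message x ms p eq)

Origin : ∀ {d k} → Local d → Vec Bits k → Local d → Set
Origin x ms x′ = (best x′ ≡ best x × right x′ ≡ right x) ⊎
                 ∃ λ p → ∃ λ b → lookup ms p ≡ b ∷ best x′ × right x′ ≡ not b

origin-∷ : ∀ {d k} {x : Local d} {ms : Vec Bits k} m {x′} → Origin x ms x′ → Origin x (m ∷ ms) x′
origin-∷ m (inj₁ same)               = inj₁ same
origin-∷ m (inj₂ (p , b , eq , eq′)) = inj₂ (suc p , b , eq , eq′)

improveAll-origin : ∀ {d k} (x : Local d) (ms : Vec Bits k) → Origin x ms (improveAll x ms)
improveAll-origin x []        = inj₁ (refl , refl)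
improveAll-origin x ([] ∷ ms) = origin-∷ {x = x} {ms} [] {improveAll x ms} (improveAll-origin x ms)
improveAll-origin x ((b ∷ id) ∷ ms) with best (improveAll x ms) ⊑? id
... | no _  = inj₂ (zero , b , refl , refl)
... | yes _ = origin-∷ {x = x} {ms} (b ∷ id) {improveAll x ms} (improveAll-origin x ms)

improve-mate : ∀ {d} m (x : Local d) → mate (improve m x) ≡ mate x
improve-mate []       x = refl
improve-mate (b ∷ id) x with best x ⊑? id
... | yes _ = refl
... | no _  = refl

improveAll-mate : ∀ {d k} (x : Local d) (ms : Vec Bits k) → mate (improveAll x ms) ≡ mate x
improveAll-mate x []       = refl
improveAll-mate x (m ∷ ms) = trans (improve-mate m (improveAll x ms)) (improveAll-mate x ms)

≡-from-false : ∀ {a b} → (a ≡ false → b ≡ false) → (b ≡ false → a ≡ false) → a ≡ b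
≡-from-false {true}  {true}  _ _ = refl
≡-from-false {false} {b}     f _ = sym (f refl)
≡-from-false {true}  {false} _ g = g refl

-- An idealised stage in which all nodes take part and nobody halts. `Run` shows that the real
-- execution agrees with it on the nodes still running.
module Semantics {c n : ℕ} (N : Network c n) where

  G : Graph n
  G = graph N

  nbr : ∀ v → Fin (deg N v) → Fin n
  nbr v p = proj₁ (Inverse.to (port N v) p)

  nbr-adj : ∀ v p → Adj G v (nbr v p)
  nbr-adj v p = proj₂ (Inverse.to (port N v) p)

  back : ∀ v p → Fin (deg N (nbr v p))
  back v p = Inverse.from (port N (nbr v p)) (v , symm G (nbr-adj v p))

  nbr-back : ∀ v p → nbr (nbr v p) (back v p) ≡ v
  nbr-back v p = cong proj₁ (Inverse.strictlyInverseˡ (port N (nbr v p)) (v , symm G (nbr-adj v p)))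

  portTo : ∀ {v u} → Adj G v u → ∃ λ p → nbr v p ≡ u
  portTo {v} {u} e = Inverse.from (port N v) (u , e) ,
    cong proj₁ (Inverse.strictlyInverseˡ (port N v) (u , e))

  neighbour-≡ : ∀ {v} {x y : Neighbour G v} → proj₁ x ≡ proj₁ y → x ≡ y
  neighbour-≡ {x = u , e} {y = .u , e′} refl = cong (u ,_) (T-irrelevant e e′)

  nbr-injective : ∀ v {p q} → nbr v p ≡ nbr v q → p ≡ q
  nbr-injective v {p} {q} eq = trans (sym (Inverse.strictlyInverseʳ (port N v) p))
    (trans (cong (Inverse.from (port N v)) (neighbour-≡ eq)) (Inverse.strictlyInverseʳ (port N v) q))

  nbr-≡⇒adj : ∀ {v p u} → nbr v p ≡ u → Adj G v u
  nbr-≡⇒adj {v} {p} refl = nbr-adj v p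

  -- Crossing an edge twice returns to the same port. The two ports belong to nodes that are only
  -- propositionally equal, so the fact is phrased as the transport of a dependent predicate.
  back-back : ∀ (P : ∀ u → Fin (deg N u) → Set) u q → P u q →
              P (nbr (nbr u q) (back u q)) (back (nbr u q) (back u q))
  back-back P u q pq =
    subst (λ x → P (proj₁ x) (Inverse.from (port N (proj₁ x)) (nbr u q , symm G (proj₂ x))))
          (sym (Inverse.strictlyInverseˡ (port N (nbr u q)) (u , symm G (nbr-adj u q))))
          (subst (P u) (sym (trans (cong (Inverse.from (port N u)) (neighbour-≡ refl))
                                   (Inverse.strictlyInverseʳ (port N u) q))) pq)

  Config : Set
  Config = ∀ v → Local (deg N v)

  inbox : Instr → Config → ∀ v → Vec Bits (deg N v)
  inbox I σ v = tabulate λ p → emit I (σ (nbr v p)) (back v p)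

  step : Instr → Config → Config
  step I σ v = absorb I (σ v) (inbox I σ v)

  exec : List Instr → Config → Config
  exec []       σ = σ
  exec (I ∷ is) σ = exec is (step I σ)

  exec-++ : ∀ is js σ → exec (is ++ js) σ ≡ exec js (exec is σ)
  exec-++ []       js σ = refl
  exec-++ (I ∷ is) js σ = exec-++ is js (step I σ)

  heard : Signal → Config → ∀ v → Maybe (Fin (deg N v))
  heard I σ v = firstOffer (inbox (signal I) σ v)

  act : Signal → Config → Config
  act I σ v = react I (σ v) (heard I σ v)

  run : List Signal → Config → Config
  run []       σ = σ
  run (I ∷ is) σ = run is (act I σ)

  run-++ : ∀ is js σ → run (is ++ js) σ ≡ run js (run is σ)
  run-++ []       js σ = refl
  run-++ (I ∷ is) js σ = run-++ is js (act I σ)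

  exec-signals : ∀ is σ → exec (map signal is) σ ≡ run is σ
  exec-signals []       σ = refl
  exec-signals (I ∷ is) σ = exec-signals is (act I σ)

  Points : Config → Fin n → Fin n → Set
  Points σ v u = ∃ λ p → mate (σ v) ≡ just p × nbr v p ≡ u

  points-unique : ∀ σ {v u u′} → Points σ v u → Points σ v u′ → u ≡ u′
  points-unique σ {v} (p , m , eq) (p′ , m′ , eq′) =
    trans (sym eq) (trans (cong (nbr v) (just-injective (trans (sym m) m′))) eq′)

  heard-just : ∀ I σ {v p} → heard I σ v ≡ just p →
               ∃ λ q → nbr (nbr v p) q ≡ v × Offer I (σ (nbr v p)) q
  heard-just I σ {v} {p} eq = back v p , nbr-back v p ,
    toWitness (subst T (sym (trans (sym (isOffer-tabulate offers p))
                                   (firstOffer-just (inbox (signal I) σ v) eq))) tt)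
    where
    offers : Fin (deg N v) → Bool
    offers p = ⌊ offer? I (σ (nbr v p)) (back v p) ⌋

  heard-nothing : ∀ I σ {v} → heard I σ v ≡ nothing →
                  ∀ u q → nbr u q ≡ v → ¬ Offer I (σ u) q
  heard-nothing I σ eq u q refl offer =
    subst T (trans (sym (isOffer-tabulate offers (back u q)))
                   (firstOffer-nothing (inbox (signal I) σ (nbr u q)) eq (back u q)))
            (fromWitness (back-back (λ w r → Offer I (σ w) r) u q offer))
    where
    offers : Fin (deg N (nbr u q)) → Bool
    offers p = ⌊ offer? I (σ (nbr (nbr u q) p)) (back (nbr u q) p) ⌋

  heard-some : ∀ I σ {u q v} → nbr u q ≡ v → Offer I (σ u) q → ∃ λ p → heard I σ v ≡ just p
  heard-some I σ {u} {q} {v} eq offer with heard I σ v in h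
  ... | just p  = p , refl
  ... | nothing = ⊥-elim (heard-nothing I σ h u q eq offer)

  run-quiet : ∀ is σ v → fail (run is σ v) ≡ false → fail (σ v) ≡ false
  run-quiet []       σ v q = q
  run-quiet (I ∷ is) σ v q = react-quiet I (σ v) _ (run-quiet is (act I σ) v q)

  -- Since `here` is available at every index, the index bounds the number of steps from above.
  data Walk (v : Fin n) : ℕ → Fin n → Set where
    here : ∀ {m} → Walk v m v
    _▸_  : ∀ {m u w} → Walk v m u → Adj G u w → Walk v (suc m) w

  walk-mono : ∀ {m k v w} → m ≤ k → Walk v m w → Walk v k w
  walk-mono m≤k       here    = here
  walk-mono (s≤s m≤k) (a ▸ e) = walk-mono m≤k a ▸ e

  _◂_ : ∀ {m u v w} → Adj G u v → Walk v m w → Walk u (suc m) w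
  e ◂ here     = here ▸ e
  e ◂ (a ▸ e′) = (e ◂ a) ▸ e′

  walk-sym : ∀ {m v w} → Walk v m w → Walk w m v
  walk-sym here    = here
  walk-sym (a ▸ e) = symm G e ◂ walk-sym a

  walk-trans : ∀ {m k u v w} → Walk u m v → Walk v k w → Walk u (k + m) w
  walk-trans {m} {k} a here = walk-mono (m≤n+m m k) a
  walk-trans a (b ▸ e)      = walk-trans a b ▸ e

  Quiet : Config → Fin n → Set
  Quiet σ v = fail (σ v) ≡ false

  spread-quiet⁻ : ∀ σ {v} → Quiet (act spread σ) v → ∀ {u} → Adj G v u → Quiet σ u
  spread-quiet⁻ σ {v} q {u} e with fail (σ u) in f
  ... | false = refl
  ... | true with portTo (symm G e)
  ...   | p , eq with heard-some spread σ {u} {p} eq f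
  ...     | r , h with trans (sym (∨-conicalʳ (fail (σ v)) _ q)) (cong is-just h)
  ...       | ()

  spread-quiet⁺ : ∀ σ {v} → Quiet σ v → (∀ {u} → Adj G v u → Quiet σ u) → Quiet (act spread σ) v
  spread-quiet⁺ σ {v} q all with fail (σ v) | heard spread σ v in h
  ... | false | nothing = refl
  ... | false | just p with heard-just spread σ h
  ...   | r , _ , f with trans (sym (all (nbr-adj v p))) f
  ...     | ()

  spreads-quiet⁻ : ∀ m σ {v} → Quiet (run (replicate m spread) σ) v → ∀ {w} → Walk v m w → Quiet σ w
  spreads-quiet⁻ m       σ q here    = run-quiet (replicate m spread) σ _ q
  spreads-quiet⁻ (suc m) σ q (a ▸ e) = spread-quiet⁻ σ (spreads-quiet⁻ m (act spread σ) q a) e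

  spreads-quiet⁺ : ∀ m σ {v} → (∀ {w} → Walk v m w → Quiet σ w) → Quiet (run (replicate m spread) σ) v
  spreads-quiet⁺ zero    σ all = all here
  spreads-quiet⁺ (suc m) σ all = spreads-quiet⁺ m (act spread σ)
    (λ a → spread-quiet⁺ σ (all (walk-mono (n≤1+n m) a)) (λ e → all (a ▸ e)))

  initial : Config
  initial v = start (ident N v)

  Proper : (Fin n → Bool) → Set
  Proper side = ∀ {u v} → Adj G u v → side u ≢ side v

  -- The parity is measured against an arbitrary proper 2-colouring: each edge flips the colour as
  -- well as the transmitted bit, so the equation survives flooding along any walk.
  record Knows (m : ℕ) (σ : Config) (v : Fin n) : Set where
    field
      leader  : Fin n
      path    : Walk leader m v
      elected : best (σ v) ≡ ident N leader
      parity  : ∀ side → Proper side → right (σ v) ≡ side leader xor side v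

  open Knows

  Lowest : ℕ → Config → Fin n → Set
  Lowest m σ v = ∀ {w} → Walk w m v → best (σ v) ⊑ ident N w

  xor-flip : ∀ a b c → b ≢ c → not (a xor b) ≡ a xor c
  xor-flip a true  true  ne = ⊥-elim (ne refl)
  xor-flip a false false ne = ⊥-elim (ne refl)
  xor-flip true  true  false ne = refl
  xor-flip true  false true  ne = refl
  xor-flip false true  false ne = refl
  xor-flip false false true  ne = refl

  flood-knows : ∀ m σ → (∀ v → Knows m σ v) → ∀ v → Knows (suc m) (step flood σ) v
  flood-knows m σ k v with improveAll-origin (σ v) (inbox flood σ v)
  ... | inj₁ (eqb , eqr) = record
    { leader = leader (k v) ; path = walk-mono (n≤1+n m) (path (k v))
    ; elected = trans eqb (elected (k v))
    ; parity = λ side proper → trans eqr (parity (k v) side proper) }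
  ... | inj₂ (p , b , eq , eqr)
    with trans (sym (lookup∘tabulate (λ p → emit flood (σ (nbr v p)) (back v p)) p)) eq
  ...   | msg = record
    { leader = leader (k u) ; path = path (k u) ▸ symm G (nbr-adj v p)
    ; elected = trans (sym (∷-injectiveʳ msg)) (elected (k u))
    ; parity = λ side proper →
        trans eqr (trans (cong not (trans (sym (∷-injectiveˡ msg)) (parity (k u) side proper)))
          (xor-flip (side (leader (k u))) (side u) (side v) (proper (symm G (nbr-adj v p))))) }
    where
    u = nbr v p

  flood-lowest : ∀ m σ → (∀ v → Lowest m σ v) → ∀ v → Lowest (suc m) (step flood σ) v
  flood-lowest m σ low v here = ⊑-trans (improveAll-below (σ v) (inbox flood σ v)) (low v here)
  flood-lowest m σ low v (_▸_ {u = u} a e) with portTo (symm G e)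
  ... | p , refl = ⊑-trans
    (improveAll-below-message (σ v) (inbox flood σ v) p
      (lookup∘tabulate (λ p → emit flood (σ (nbr v p)) (back v p)) p))
    (low u a)

  floods : ∀ (Inv : ℕ → Config → Set) → (∀ m σ → Inv m σ → Inv (suc m) (step flood σ)) →
           ∀ k m σ → Inv m σ → Inv (k + m) (exec (replicate k flood) σ)
  floods Inv next zero    m σ inv = inv
  floods Inv next (suc k) m σ inv =
    subst (λ j → Inv j (exec (replicate k flood) (step flood σ))) (+-suc k m)
          (floods Inv next k (suc m) (step flood σ) (next m σ inv))

  flooded : ℕ → Config
  flooded s = exec (replicate (radius s) flood) initial

  flooded-knows : ∀ s v → Knows (radius s) (flooded s) v
  flooded-knows s = subst (λ m → ∀ v → Knows m (flooded s) v) (+-identityʳ (radius s))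
    (floods (λ m σ → ∀ v → Knows m σ v) flood-knows (radius s) 0 initial λ v → record
      { leader = v ; path = here ; elected = refl ; parity = λ side _ → sym (xor-same (side v)) })

  flooded-lowest : ∀ s v → Lowest (radius s) (flooded s) v
  flooded-lowest s = subst (λ m → ∀ v → Lowest m (flooded s) v) (+-identityʳ (radius s))
    (floods (λ m σ → ∀ v → Lowest m σ v) flood-lowest (radius s) 0 initial λ { v here → ⊑-refl })

  flooded-mate : ∀ s v → mate (flooded s v) ≡ nothing
  flooded-mate s = floods (λ _ σ → ∀ v → mate (σ v) ≡ nothing)
    (λ _ σ none v → trans (improveAll-mate (σ v) (inbox flood σ v)) (none v))
    (radius s) 0 initial (λ _ → refl)

  agree-quiet⁻ : ∀ σ {v u} → Quiet (step agree σ) v → Adj G v u → best (σ u) ≡ best (σ v)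
  agree-quiet⁻ σ {v} q e with consistent? (σ v) (inbox agree σ v)
  ... | yes same with portTo e
  ...   | p , refl =
    ∷-injectiveʳ (trans (sym (lookup∘tabulate (λ p → emit agree (σ (nbr v p)) (back v p)) p)) (same p))

  agree-quiet⁺ : ∀ σ {v} →
    (∀ {u} → Adj G v u → best (σ u) ≡ best (σ v) × right (σ u) ≡ not (right (σ v))) →
    Quiet (step agree σ) v
  agree-quiet⁺ σ {v} same with consistent? (σ v) (inbox agree σ v)
  ... | yes _  = refl
  ... | no ¬same = ⊥-elim (¬same λ p → trans (lookup∘tabulate (λ p → emit agree (σ (nbr v p)) (back v p)) p)
                    (cong₂ _∷_ (proj₂ (same (nbr-adj v p))) (proj₁ (same (nbr-adj v p)))))

  agreed matched verified : ℕ → Config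
  agreed s   = step agree (flooded s)
  matched s  = run (matching s) (agreed s)
  verified s = run verify (matched s)

  -- Opaque, so that types mentioning `final` do not unfold a whole stage.
  abstract
    final : ℕ → Config
    final s = run (replicate (2 * radius s) spread) (verified s)

    final-≡ : ∀ s → final s ≡ run (replicate (2 * radius s) spread) (verified s)
    final-≡ s = refl

  final-quiet⁻ : ∀ s {v} → Quiet (final s) v → ∀ {w} → Walk v (2 * radius s) w → Quiet (verified s) w
  final-quiet⁻ s {v} q = spreads-quiet⁻ (2 * radius s) (verified s)
    (subst (λ σ → fail (σ v) ≡ false) (final-≡ s) q)

  final-quiet⁺ : ∀ s {v} → (∀ {w} → Walk v (2 * radius s) w → Quiet (verified s) w) → Quiet (final s) v
  final-quiet⁺ s {v} all = subst (λ σ → fail (σ v) ≡ false) (sym (final-≡ s))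
    (spreads-quiet⁺ (2 * radius s) (verified s) all)

  exec-stage : ∀ s → exec (stage s) initial ≡ final s
  exec-stage s =
    trans (exec-++ (replicate (radius s) flood) _ initial)
    (trans (exec-signals (matching s ++ verify ++ spreads) (agreed s))
    (trans (run-++ (matching s) (verify ++ spreads) (agreed s))
    (trans (run-++ verify spreads (matched s)) (sym (final-≡ s)))))
    where
    spreads = replicate (2 * radius s) spread

  verified-agreed : ∀ s {v} → Quiet (verified s) v → Quiet (agreed s) v
  verified-agreed s {v} q = run-quiet (matching s) (agreed s) v (run-quiet verify (matched s) v q)

  -- Within the region that v hears from, everybody has the leader of v, which is
  -- at distance at most the radius; hence that region is the whole component.
  quiet-component : ∀ s {v} → Quiet (final s) v → ∀ {m w} → Walk v m w → Walk v (2 * radius s) w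
  quiet-component s {v} q = λ a → proj₁ (reach a)
    where
    R = radius s
    knows = flooded-knows s
    near : ∀ {w} → Walk v (2 * R) w → Quiet (agreed s) w
    near a = verified-agreed s (final-quiet⁻ s q a)
    reach : ∀ {m w} → Walk v m w → Walk v (2 * R) w × best (flooded s w) ≡ best (flooded s v)
    reach here = here , refl
    reach (_▸_ {u = u} {w} a e) with reach a
    ... | b , same = subst (λ k → Walk v k w) (cong (R +_) (sym (+-identityʳ R)))
                       (walk-trans (walk-sym (path (knows v)))
                         (subst (λ ℓ → Walk ℓ R w) sameLeader (path (knows w)))) , same′
      where
      same′ : best (flooded s w) ≡ best (flooded s v)
      same′ = trans (agree-quiet⁻ (flooded s) (near b) e) same
      sameLeader : leader (knows w) ≡ leader (knows v)
      sameLeader = ident-inj N (trans (sym (elected (knows w))) (trans same′ (elected (knows v))))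

  -- The ball around `v` is already its whole component, so every node that `u` hears from has been
  -- heard, without failure, by `v`.
  quiet-adj : ∀ s {u v} → Adj G v u → Quiet (final s) v → Quiet (final s) u
  quiet-adj s e q = final-quiet⁺ s (λ a → final-quiet⁻ s q (quiet-component s q (e ◂ a)))

  final-fail-adj : ∀ s {u v} → Adj G v u → fail (final s v) ≡ fail (final s u)
  final-fail-adj s e = ≡-from-false (quiet-adj s e) (quiet-adj s (symm G e))

-- Executions

module Run {c n : ℕ} (N : Network c n) where
  open Semantics N
  open Execution algorithm N hiding (Config)

  -- Predicts the halting stage from the idealised stages, which do not depend on who has halted.
  -- Being constant along edges, the prediction can be compared with the real execution.
  haltedBy : ℕ → Fin n → Maybe ℕ
  haltedBy zero    v = nothing
  haltedBy (suc s) v = haltedBy s v <∣> (if fail (final s v) then nothing else just s)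

  haltedBy-adj : ∀ s {u v} → Adj G u v → haltedBy s u ≡ haltedBy s v
  haltedBy-adj zero    e = refl
  haltedBy-adj (suc s) e =
    cong₂ (λ h f → h <∣> (if f then nothing else just s)) (haltedBy-adj s e) (final-fail-adj s e)

  haltedBy-quiet : ∀ s {v s′} → haltedBy s v ≡ just s′ → Quiet (final s′) v
  haltedBy-quiet (suc s) {v} eq with haltedBy s v in before
  haltedBy-quiet (suc s)     refl | just _  = haltedBy-quiet s before
  haltedBy-quiet (suc s) {v} eq   | nothing = quiet (fail (final s v)) refl eq
    where
    quiet : ∀ f {s′} → f ≡ fail (final s v) → (if f then nothing else just s) ≡ just s′ →
            Quiet (final s′) v
    quiet false f≡ refl = sym f≡

  quiet-haltedBy : ∀ s {v} → Quiet (final s) v → ∃ λ s′ → haltedBy (suc s) v ≡ just s′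
  quiet-haltedBy s {v} q with haltedBy s v
  ... | just s′ = s′ , refl
  ... | nothing = s , cong (if_then nothing else just s) q

  verdict : Fin n → ℕ → Bool
  verdict v s = inCover (final s v)

  snapshot : ℕ → List Instr → Config → ∀ v → Maybe ℕ → Running (deg N v) ⊎ Bool
  snapshot s is τ v (just s′) = inj₂ (verdict v s′)
  snapshot s is τ v nothing   = inj₁ (running (ident N v) s is (τ v))

  sent-running : ∀ {σ : ∀ v → Running (deg N v) ⊎ Bool} {v r} p → σ v ≡ inj₁ r → sent σ v p ≡ emitNow r p
  sent-running {σ} {v} p eq with σ v
  sent-running p refl | inj₁ r = refl

  round-running : ∀ {σ : ∀ v → Running (deg N v) ⊎ Bool} {v r} → σ v ≡ inj₁ r →
                  round σ v ≡ absorbNow r (tabulate (received σ v))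
  round-running {σ} {v} eq with σ v
  round-running refl | inj₁ r = refl

  round-halted : ∀ {σ : ∀ v → Running (deg N v) ⊎ Bool} {v b} → σ v ≡ inj₂ b → round σ v ≡ inj₂ b
  round-halted {σ} {v} eq with σ v
  round-halted refl | inj₂ b = refl

  -- All neighbours of a running node are running, by `haltedBy-adj`, so its real inbox is the
  -- idealised one.
  round-step : ∀ {σ : ∀ v → Running (deg N v) ⊎ Bool} {s I is τ} →
               (∀ v → σ v ≡ snapshot s (I ∷ is) τ v (haltedBy s v)) →
               ∀ {v} → haltedBy s v ≡ nothing → round σ v ≡ finish (ident N v) s is (step I τ v)
  round-step {σ} {s} {I} {is} {τ} inv {v} active =
    trans (round-running {σ = σ} (trans (inv v) (cong (snapshot s (I ∷ is) τ v) active)))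
          (cong (λ ms → finish (ident N v) s is (absorb I (τ v) ms))
                (tabulate-cong λ p → sent-running {σ = σ} (back v p)
                  (trans (inv (nbr v p)) (cong (snapshot s (I ∷ is) τ (nbr v p))
                    (trans (haltedBy-adj s (symm G (nbr-adj v p))) active)))))

  advance : ∀ {s I J is τ t} → (∀ v → after t v ≡ snapshot s (I ∷ J ∷ is) τ v (haltedBy s v)) →
            ∀ v → after (suc t) v ≡ snapshot s (J ∷ is) (step I τ) v (haltedBy s v)
  advance {s} {I} {J} {is} {τ} {t} inv v with haltedBy s v in h
  ... | just s′ = round-halted {σ = after t} (trans (inv v) (cong (snapshot s (I ∷ J ∷ is) τ v) h))
  ... | nothing = round-step {σ = after t} inv h

  finish-snapshot : ∀ s v x → inCover x ≡ verdict v s →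
    finish (ident N v) s [] x ≡
    snapshot (suc s) (stage (suc s)) initial v (if fail x then nothing else just s)
  finish-snapshot s v x eq with fail x
  ... | true  = refl
  ... | false = cong inj₂ eq

  advance-stage : ∀ {s I τ t} → step I τ ≡ final s →
                  (∀ v → after t v ≡ snapshot s (I ∷ []) τ v (haltedBy s v)) →
                  ∀ v → after (suc t) v ≡ snapshot (suc s) (stage (suc s)) initial v (haltedBy (suc s) v)
  advance-stage {s} {I} {τ} {t} end inv v with haltedBy s v in h
  ... | just s′ = round-halted {σ = after t} (trans (inv v) (cong (snapshot s (I ∷ []) τ v) h))
  ... | nothing = trans (round-step {σ = after t} inv h)
    (trans (cong (λ σ → finish (ident N v) s [] (σ v)) end) (finish-snapshot s v (final s v) refl))

  run-stage : ∀ {s} I is τ t → exec (I ∷ is) τ ≡ final s →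
              (∀ v → after t v ≡ snapshot s (I ∷ is) τ v (haltedBy s v)) →
              ∀ v → after (suc (length is) + t) v ≡
                    snapshot (suc s) (stage (suc s)) initial v (haltedBy (suc s) v)
  run-stage I []       τ t end inv = advance-stage {t = t} end inv
  run-stage {s} I (J ∷ is) τ t end inv v =
    subst (λ k → after (suc k) v ≡ snapshot (suc s) (stage (suc s)) initial v (haltedBy (suc s) v))
          (+-suc (length is) t)
          (run-stage J is (step I τ) (suc t) end (advance {t = t} inv) v)

  clock : ℕ → ℕ
  clock zero    = 0
  clock (suc s) = length (stage s) + clock s

  after-clock : ∀ s v → after (clock s) v ≡ snapshot s (stage s) initial v (haltedBy s v)
  after-clock zero    v = refl
  after-clock (suc s) v = run-stage flood _ initial (clock s) (exec-stage s) (after-clock s) v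

-- Local certificates of optimality

-- Another cover contains `v` or its partner, because they are adjacent. Sending `v` to itself in
-- the first case and to the partner in the second is injective: the first kind of image lies in
-- `S`, the second outside, and partners are not shared.
certificate⇒minimum : ∀ {n} (G : Graph n) (S : Subset n) (Partner : Fin n → Fin n → Set) →
  IsVertexCover G S →
  (∀ {v} → v ∈ S → ∃ λ u → Partner v u × Adj G v u × u ∉ S) →
  (∀ {v v′ u} → Partner v u → Partner v′ u → v ≡ v′) →
  IsMinimumVertexCover G S
certificate⇒minimum {n} G S Partner cov partner unique = (λ {u} {v} → cov {u} {v}) , λ S′ cov′ →
  subst₂ _≤_ (sym (∣∣≡count S)) (sym (∣∣≡count S′))
    (count-inj (_∈? S) (_∈? S′) Image (image S′ cov′) injective)
  where
  Image : Fin n → Fin n → Set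
  Image v w = v ∈ S × (w ≡ v ⊎ (Partner v w × w ∉ S))
  image : ∀ S′ → IsVertexCover G S′ → ∀ v → v ∈ S → ∃ λ w → w ∈ S′ × Image v w
  image S′ cov′ v v∈S with partner v∈S
  ... | u , pt , e , u∉S with cov′ e
  ...   | inj₁ v∈S′ = v , v∈S′ , v∈S , inj₁ refl
  ...   | inj₂ u∈S′ = u , u∈S′ , v∈S , inj₂ (pt , u∉S)
  injective : ∀ {v v′ w} → Image v w → Image v′ w → v ≡ v′
  injective (_   , inj₁ refl)     (_    , inj₁ refl)       = refl
  injective (v∈S , inj₁ refl)     (_    , inj₂ (_ , w∉S))  = ⊥-elim (w∉S v∈S)
  injective (_   , inj₂ (_ , w∉S)) (v′∈S , inj₁ refl)      = ⊥-elim (w∉S v′∈S)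
  injective (_   , inj₂ (pt , _)) (_    , inj₂ (pt′ , _))  = unique pt pt′

∈-tabulate⁺ : ∀ {n} (f : Fin n → Bool) {v} → f v ≡ true → v ∈ tabulate f
∈-tabulate⁺ f {v} eq = lookup⇒[]= v (tabulate f) (trans (lookup∘tabulate f v) eq)

∈-tabulate⁻ : ∀ {n} (f : Fin n → Bool) {v} → v ∈ tabulate f → f v ≡ true
∈-tabulate⁻ f {v} v∈ = trans (sym (lookup∘tabulate f v)) ([]=⇒lookup v∈)

select : ∀ {n} {P : Pred (Fin n) 0ℓ} → Decidable P → Subset n
select P? = tabulate (λ v → ⌊ P? v ⌋)

∈-select⁺ : ∀ {n} {P : Pred (Fin n) 0ℓ} (P? : Decidable P) {v} → P v → v ∈ select P?
∈-select⁺ P? {v} p = ∈-tabulate⁺ (λ v → ⌊ P? v ⌋) (trans (isYes≗does (P? v)) (dec-true (P? v) p))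

∈-select⁻ : ∀ {n} {P : Pred (Fin n) 0ℓ} (P? : Decidable P) {v} → v ∈ select P? → P v
∈-select⁻ P? {v} v∈ = toWitness (subst T (sym (∈-tabulate⁻ (λ v → ⌊ P? v ⌋) v∈)) tt)

confirms-just : ∀ {d} (m h : Maybe (Fin d)) → confirms m h ≡ true → ∃ λ p → m ≡ just p × h ≡ just p
confirms-just (just p) (just q) eq with p ≟ᶠ q
... | yes refl = p , refl , refl

module Certificate {c n : ℕ} (N : Network c n) where
  open Semantics N
  open Run N

  uncovered-quiet⁻ : ∀ σ {v u} → Quiet (act uncovered σ) v → Adj G v u →
                     inCover (σ v) ≡ true ⊎ inCover (σ u) ≡ true
  uncovered-quiet⁻ σ {v} {u} q e with inCover (σ v) in cv | inCover (σ u) in cu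
  ... | true  | _     = inj₁ refl
  ... | false | true  = inj₂ refl
  ... | false | false with portTo (symm G e)
  ...   | r , eq with heard-some uncovered σ {u} {r} eq cu
  ...     | p , h with trans (sym (∨-conicalʳ (fail (σ v)) _ q)) (cong is-just h)
  ...       | ()

  -- Holds for arbitrary configurations. Only the pointer from `u` to `v` is kept, and uniqueness of
  -- its target is all that the certificate asks of partners.
  unmated-quiet⁻ : ∀ σ {v} → Quiet (act unmated σ) v → inCover (σ v) ≡ true →
                   ∃ λ u → Adj G v u × inCover (σ u) ≡ false × Points σ u v
  unmated-quiet⁻ σ {v} q cv with inCover (σ v)
  unmated-quiet⁻ σ {v} q refl | true
    with confirms-just (mate (σ v)) (heard unmated σ v) (not-injective (∨-conicalʳ (fail (σ v)) _ q))
  ... | p , _ , h with heard-just unmated σ h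
  ...   | r , eq , cu , mu = nbr v p , nbr-adj v p , cu , r , mu , eq

  spreads-mate : ∀ m σ v → mate (run (replicate m spread) σ v) ≡ mate (σ v)
  spreads-mate zero    σ v = refl
  spreads-mate (suc m) σ v = spreads-mate m (act spread σ) v

  spreads-inCover : ∀ m σ v → inCover (run (replicate m spread) σ v) ≡ inCover (σ v)
  spreads-inCover zero    σ v = refl
  spreads-inCover (suc m) σ v = spreads-inCover m (act spread σ) v

  final-mate : ∀ s v → mate (final s v) ≡ mate (matched s v)
  final-mate s v = trans (cong (λ σ → mate (σ v)) (final-≡ s))
                         (spreads-mate (2 * radius s) (verified s) v)

  final-inCover : ∀ s v → inCover (final s v) ≡ inCover (matched s v)
  final-inCover s v = trans (cong (λ σ → inCover (σ v)) (final-≡ s))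
                            (spreads-inCover (2 * radius s) (verified s) v)

  final-covered : ∀ s {v u} → Quiet (final s) v → Adj G v u → verdict v s ≡ true ⊎ verdict u s ≡ true
  final-covered s {v} {u} q e with uncovered-quiet⁻ (matched s)
    (react-quiet unmated (act uncovered (matched s) v) (heard unmated (act uncovered (matched s)) v)
                 (final-quiet⁻ s q here)) e
  ... | inj₁ cv = inj₁ (trans (final-inCover s v) cv)
  ... | inj₂ cu = inj₂ (trans (final-inCover s u) cu)

  final-mated : ∀ s {v} → Quiet (final s) v → verdict v s ≡ true →
                ∃ λ u → Adj G v u × verdict u s ≡ false × Points (final s) u v
  final-mated s {v} q cv
    with unmated-quiet⁻ (act uncovered (matched s)) (final-quiet⁻ s q here)
                        (trans (sym (final-inCover s v)) cv)
  ... | u , e , cu , p , mu , eq = u , e , trans (final-inCover s u) cu , p , trans (final-mate s u) mu , eq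

  -- The output is assembled from different stages, one per component. As `at` is constant along
  -- edges, the certificates at the two ends of an edge stem from the same stage.
  halted-minimum : ∀ s (at : Fin n → ℕ) → (∀ v → haltedBy s v ≡ just (at v)) →
                   ∃ λ S → HaltsWith algorithm N (clock s) S × IsMinimumVertexCover G S
  halted-minimum s at at-≡ = S , halted , certificate⇒minimum G S Partner covers partner unique
    where
    at-adj : ∀ {u v} → Adj G u v → at u ≡ at v
    at-adj {u} {v} e = just-injective (trans (sym (at-≡ u)) (trans (haltedBy-adj s e) (at-≡ v)))
    at-quiet : ∀ v → Quiet (final (at v)) v
    at-quiet v = haltedBy-quiet s (at-≡ v)
    out : Fin n → Bool
    out v = verdict v (at v)
    S : Subset n
    S = tabulate out
    halted : HaltsWith algorithm N (clock s) S
    halted v = trans (after-clock s v)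
      (trans (cong (snapshot s (stage s) initial v) (at-≡ v))
             (cong inj₂ (sym (lookup∘tabulate out v))))
    Partner : Fin n → Fin n → Set
    Partner v u = Points (final (at u)) u v
    covers : IsVertexCover G S
    covers {u} {v} e with final-covered (at u) (at-quiet u) e
    ... | inj₁ cu = inj₁ (∈-tabulate⁺ out cu)
    ... | inj₂ cv = inj₂ (∈-tabulate⁺ out (trans (cong (verdict v) (sym (at-adj e))) cv))
    true≢false : true ≢ false
    true≢false ()
    partner : ∀ {v} → v ∈ S → ∃ λ u → Partner v u × Adj G v u × u ∉ S
    partner {v} v∈S =
      let u , e , cu , pt = final-mated (at v) (at-quiet v) (∈-tabulate⁻ out v∈S)
      in  u , subst (λ k → Points (final k) u v) (at-adj e) pt , e ,
          λ u∈S → true≢false (trans (sym (∈-tabulate⁻ out u∈S))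
                                    (trans (cong (verdict u) (sym (at-adj e))) cu))
    unique : ∀ {v v′ u} → Partner v u → Partner v′ u → v ≡ v′
    unique {u = u} = points-unique (final (at u))

  halts : ∀ s → (∀ v → Quiet (final s) v) →
          ∃ λ S → HaltsWith algorithm N (clock (suc s)) S × IsMinimumVertexCover G S
  halts s quiet = halted-minimum (suc s) (λ v → proj₁ (quiet-haltedBy s (quiet v)))
                                         (λ v → proj₂ (quiet-haltedBy s (quiet v)))

-- Augmenting the matching

grow-old : ∀ i {d} (x : Local d) h {m} → level x ≡ suc m →
           level (react (grow i) x h) ≡ suc m × parent (react (grow i) x h) ≡ parent x
grow-old i x h eq with right x | level x
grow-old i x h refl | false | suc m = refl , refl
grow-old i x h refl | true  | suc m = refl , refl

grow-left : ∀ i {d} (x : Local d) h → right x ≡ false → level (react (grow i) x h) ≡ level x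
grow-left i x h eq with right x
grow-left i x h refl | false = refl

grow-fresh : ∀ i {d} (x : Local d) p → right x ≡ true → level x ≡ 0 →
             level (react (grow i) x (just p)) ≡ i
grow-fresh i x p eq eq′ with right x | level x
grow-fresh i x p refl refl | true | 0 = refl

grow-new : ∀ i {d} (x : Local d) h {m} → level (react (grow i) x h) ≡ suc m →
           (level x ≡ suc m × parent (react (grow i) x h) ≡ parent x) ⊎
           (right x ≡ true × i ≡ suc m × ∃ λ p → h ≡ just p × parent (react (grow i) x h) ≡ just p)
grow-new i x h        eq with right x | level x
grow-new i x h        eq | false | l     = inj₁ (eq , refl)
grow-new i x h        eq | true  | suc l = inj₁ (eq , refl)
grow-new i x (just p) eq | true  | 0     = inj₂ (refl , eq , p , refl , refl)

reply-old : ∀ i {d} (x : Local d) h {m} → level x ≡ suc m → level (react (reply i) x h) ≡ suc m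
reply-old i x h eq with right x | level x
reply-old i x h refl | false | suc m = refl
reply-old i x h refl | true  | suc m = refl

reply-right : ∀ i {d} (x : Local d) h → right x ≡ true → level (react (reply i) x h) ≡ level x
reply-right i x h eq with right x
reply-right i x h refl | true = refl

reply-fresh : ∀ i {d} (x : Local d) p → right x ≡ false → level x ≡ 0 →
              level (react (reply i) x (just p)) ≡ suc i
reply-fresh i x p eq eq′ with right x | level x
reply-fresh i x p refl refl | false | 0 = refl

reply-new : ∀ i {d} (x : Local d) h {m} → level (react (reply i) x h) ≡ suc m →
            level x ≡ suc m ⊎ (right x ≡ false × i ≡ m × ∃ λ p → h ≡ just p)
reply-new i x h        eq with right x | level x
reply-new i x h        eq   | true  | l     = inj₁ eq
reply-new i x h        eq   | false | suc l = inj₁ eq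
reply-new i x (just p) refl | false | 0     = inj₂ (refl , refl , p , refl)

root-left : ∀ {d} (x : Local d) h → right x ≡ false → level (react root x h) ≡ rootLevel (mate x)
root-left x h eq with right x
root-left x h refl | false = refl

root-right : ∀ {d} (x : Local d) h → right x ≡ true → level (react root x h) ≡ 0
root-right x h eq with right x
root-right x h refl | true = refl

just≢nothing : ∀ {A : Set} {x : Maybe A} {a : A} → x ≡ just a → x ≢ nothing
just≢nothing refl ()

≢nothing⇒just : ∀ {A : Set} {x : Maybe A} → x ≢ nothing → ∃ λ a → x ≡ just a
≢nothing⇒just {x = just a}  _  = a , refl
≢nothing⇒just {x = nothing} ≢n = ⊥-elim (≢n refl)

module Matching {c n : ℕ} (N : Network c n) (side : Fin n → Bool)
                (proper : Semantics.Proper N side) where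
  open Semantics N

  right-of : ∀ {u v} → Adj G u v → side u ≡ false → side v ≡ true
  right-of {u} {v} e su with side v in sv
  ... | true  = refl
  ... | false = ⊥-elim (proper e (trans su (sym sv)))

  left-of : ∀ {u v} → Adj G u v → side u ≡ true → side v ≡ false
  left-of {u} {v} e su with side v in sv
  ... | false = refl
  ... | true  = ⊥-elim (proper e (trans su (sym sv)))

  left-not-right : ∀ {v} {A : Set} → side v ≡ false → side v ≡ true → A
  left-not-right eq eq′ with trans (sym eq) eq′
  ... | ()

  points-adj : ∀ σ {v u} → Points σ v u → Adj G v u
  points-adj σ (p , _ , eq) = nbr-≡⇒adj eq

  matched⇒points : ∀ σ {v} → mate (σ v) ≢ nothing → ∃ λ u → Points σ v u
  matched⇒points σ {v} ≢n = let p , eq = ≢nothing⇒just ≢n in nbr v p , p , eq , refl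

  points⇒matched : ∀ σ {v u} → Points σ v u → mate (σ v) ≢ nothing
  points⇒matched σ (p , eq , _) = just≢nothing eq

  record Valid (σ : Config) : Set where
    field
      sides  : ∀ v → right (σ v) ≡ side v
      quiet  : ∀ v → Quiet σ v
      paired : ∀ {v u} → Points σ v u → Points σ u v

    right-≡ : ∀ {v b} → side v ≡ b → right (σ v) ≡ b
    right-≡ eq = trans (sides _) eq

    points-injective : ∀ {v v′ u} → Points σ v u → Points σ v′ u → v ≡ v′
    points-injective pt pt′ = points-unique σ (paired pt) (paired pt′)

  open Valid

  Saturated : Config → Fin n → Set
  Saturated σ v = side v ≡ false × mate (σ v) ≢ nothing

  saturated? : ∀ σ → Decidable (Saturated σ)
  saturated? σ v = side v ≟ᵇ false ×-dec ¬? (mate (σ v) ≟ᵐ nothing)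

  size : Config → ℕ
  size σ = count (saturated? σ)

  -- Weak duality: each matching edge is charged to one of its endpoints in the cover, and matching
  -- edges are disjoint.
  size≤cover : ∀ {σ} → Valid σ → ∀ S → IsVertexCover G S → size σ ≤ ∣ S ∣
  size≤cover {σ} valid S cov = subst (size σ ≤_) (sym (∣∣≡count S))
    (count-inj (saturated? σ) (_∈? S) Image image injective)
    where
    Image : Fin n → Fin n → Set
    Image v w = side v ≡ false × (w ≡ v ⊎ Points σ v w)
    image : ∀ v → Saturated σ v → ∃ λ w → w ∈ S × Image v w
    image v (sv , ≢n) =
      let u , pt = matched⇒points σ ≢n
      in  [ (λ v∈S → v , v∈S , sv , inj₁ refl) , (λ u∈S → u , u∈S , sv , inj₂ pt) ]′
            (cov (points-adj σ pt))
    injective : ∀ {v v′ w} → Image v w → Image v′ w → v ≡ v′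
    injective (_  , inj₁ refl) (_   , inj₁ refl) = refl
    injective (sv , inj₁ refl) (sv′ , inj₂ pt)   = left-not-right sv (right-of (points-adj σ pt) sv′)
    injective (sv , inj₂ pt)   (sv′ , inj₁ refl) = left-not-right sv′ (right-of (points-adj σ pt) sv)
    injective (_  , inj₂ pt)   (_   , inj₂ pt′)  = points-injective valid pt pt′

  claim-left : ∀ σ {v} → right (σ v) ≡ false → mate (act claim σ v) ≡ mate (σ v)
  claim-left σ {v} eq = cong (if_then heard claim σ v else mate (σ v)) eq

  claim-right : ∀ σ {v} → right (σ v) ≡ true → mate (act claim σ v) ≡ heard claim σ v
  claim-right σ {v} eq = cong (if_then heard claim σ v else mate (σ v)) eq

  claim-points⁻ : ∀ σ {w u} → right (σ w) ≡ true → Points (act claim σ) w u →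
                  right (σ u) ≡ false × Points σ u w
  claim-points⁻ σ rw (p , m , refl) =
    let q , eq , ru , mu = heard-just claim σ (trans (sym (claim-right σ rw)) m)
    in  ru , q , mu , eq

  -- A claim recomputes the right pointers as the inverse of the left ones. Hence injectivity of the
  -- left pointers is enough to restore a symmetric matching.
  module Claim {σ} (sides : ∀ v → right (σ v) ≡ side v) (quiet : ∀ v → Quiet σ v)
               (injective : ∀ {u u′ w} → side u ≡ false → side u′ ≡ false →
                            Points σ u w → Points σ u′ w → u ≡ u′) where

    claim-points⁺ : ∀ {u w} → side u ≡ false → Points σ u w → Points (act claim σ) w u
    claim-points⁺ {u} {w} su pt@(q , m , eq) =
      let p , h = heard-some claim σ {u} {q} eq (trans (sides u) su , m)
          r , eq′ , ru , mu = heard-just claim σ h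
          sw = right-of (points-adj σ pt) su
      in  p , trans (claim-right σ (trans (sides w) sw)) h ,
          injective (trans (sym (sides _)) ru) su (r , mu , eq′) pt

    claim-paired : ∀ {v u} → Points (act claim σ) v u → Points (act claim σ) u v
    claim-paired {v} {u} pt@(p , m , eq) with side v in sv
    ... | false = claim-points⁺ sv (p , trans (sym (claim-left σ (trans (sides v) sv))) m , eq)
    ... | true  = let ru , q , mu , eq′ = claim-points⁻ σ (trans (sides v) sv) pt
                  in  q , trans (claim-left σ ru) mu , eq′

    claim-valid : Valid (act claim σ)
    claim-valid = record { sides = sides ; quiet = quiet ; paired = claim-paired }

  root-valid : ∀ {σ} → Valid σ → Valid (act root σ)
  root-valid valid = record { sides = sides valid ; quiet = quiet valid ; paired = paired valid }

  -- Layered search along alternating paths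

  explore : ℕ → Config → Config
  explore i σ = act (reply i) (act (grow i) σ)

  explore-valid : ∀ {i σ} → Valid σ → Valid (explore i σ)
  explore-valid valid = record { sides = sides valid ; quiet = quiet valid ; paired = paired valid }

  -- The invariant after exploring `j` right layers. Left nodes may already have level `j + 1`, but
  -- their edges have not been explored; this is why `closed` stops at left level `j`.
  record Layered (j : ℕ) (σ : Config) : Set where
    field
      free-root   : ∀ {v} → side v ≡ false → mate (σ v) ≡ nothing → level (σ v) ≡ 1
      root-free   : ∀ {v} → side v ≡ false → level (σ v) ≡ 1 → mate (σ v) ≡ nothing
      from-mate   : ∀ {v m} → side v ≡ false → level (σ v) ≡ suc (suc m) →
                    ∃ λ w → Points σ v w × level (σ w) ≡ suc m
      from-parent : ∀ {w m} → side w ≡ true → level (σ w) ≡ suc m →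
                    ∃ λ p → parent (σ w) ≡ just p × level (σ (nbr w p)) ≡ suc m
      to-mate     : ∀ {w m u} → side w ≡ true → level (σ w) ≡ suc m → Points σ w u →
                    level (σ u) ≡ suc (suc m)
      closed      : ∀ {u m w} → side u ≡ false → level (σ u) ≡ suc m → m < j → Adj G u w →
                    ∃ λ k → level (σ w) ≡ suc k × k ≤ m
      bounded     : ∀ {w m} → side w ≡ true → level (σ w) ≡ suc m → m < j

  open Layered

  root-layered : ∀ {σ} → Valid σ → Layered 0 (act root σ)
  root-layered {σ} valid = record
    { free-root   = λ sv eq → trans (left sv) (cong rootLevel eq)
    ; root-free   = λ sv eq → free (mate (σ _)) (trans (sym (left sv)) eq)
    ; from-mate   = λ sv eq → ⊥-elim (low (mate (σ _)) (trans (sym (left sv)) eq))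
    ; from-parent = λ sw eq → ⊥-elim (0≢1+n (trans (sym (none sw)) eq))
    ; to-mate     = λ sw eq _ → ⊥-elim (0≢1+n (trans (sym (none sw)) eq))
    ; closed      = λ _ _ ()
    ; bounded     = λ sw eq → ⊥-elim (0≢1+n (trans (sym (none sw)) eq))
    }
    where
    left : ∀ {v} → side v ≡ false → level (act root σ v) ≡ rootLevel (mate (σ v))
    left {v} sv = root-left (σ v) (heard root σ v) (right-≡ valid sv)
    none : ∀ {v} → side v ≡ true → level (act root σ v) ≡ 0
    none {v} sv = root-right (σ v) (heard root σ v) (right-≡ valid sv)
    free : ∀ {d} (m : Maybe (Fin d)) → rootLevel m ≡ 1 → m ≡ nothing
    free nothing _ = refl
    low : ∀ {d k} (m : Maybe (Fin d)) → rootLevel m ≢ suc (suc k)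
    low nothing  ()
    low (just _) ()

  module Explore {j σ} (valid : Valid σ) (lay : Layered j σ) where
    σ₁ σ₂ : Config
    σ₁ = act (grow (suc j)) σ
    σ₂ = act (reply (suc j)) σ₁

    keep₁ : ∀ {v m} → level (σ v) ≡ suc m → level (σ₁ v) ≡ suc m
    keep₁ {v} eq = proj₁ (grow-old (suc j) (σ v) (heard (grow (suc j)) σ v) eq)

    keep₂ : ∀ {v m} → level (σ₁ v) ≡ suc m → level (σ₂ v) ≡ suc m
    keep₂ {v} eq = reply-old (suc j) (σ₁ v) (heard (reply (suc j)) σ₁ v) eq

    keep : ∀ {v m} → level (σ v) ≡ suc m → level (σ₂ v) ≡ suc m
    keep eq = keep₂ (keep₁ eq)

    left₁ : ∀ {v} → side v ≡ false → level (σ₁ v) ≡ level (σ v)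
    left₁ {v} sv = grow-left (suc j) (σ v) (heard (grow (suc j)) σ v) (right-≡ valid sv)

    right₂ : ∀ {v} → side v ≡ true → level (σ₂ v) ≡ level (σ₁ v)
    right₂ {v} sv = reply-right (suc j) (σ₁ v) (heard (reply (suc j)) σ₁ v) (right-≡ valid sv)

    new-left : ∀ {v m} → side v ≡ false → level (σ₂ v) ≡ suc m →
               level (σ v) ≡ suc m ⊎
               (m ≡ suc j × ∃ λ w → Points σ v w × level (σ₁ w) ≡ suc j)
    new-left {v} sv eq with reply-new (suc j) (σ₁ v) (heard (reply (suc j)) σ₁ v) eq
    ... | inj₁ eq₁                    = inj₁ (trans (sym (left₁ sv)) eq₁)
    ... | inj₂ (_ , m≡ , p , h) =
      let q , eq′ , _ , lw , mw = heard-just (reply (suc j)) σ₁ h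
      in  inj₂ (sym m≡ , nbr v p , paired valid (q , mw , eq′) , lw)

    new-right : ∀ {w m} → side w ≡ true → level (σ₂ w) ≡ suc m →
                (level (σ w) ≡ suc m × parent (σ₂ w) ≡ parent (σ w)) ⊎
                (m ≡ j × ∃ λ p → parent (σ₂ w) ≡ just p × level (σ (nbr w p)) ≡ suc j)
    new-right {w} sw eq with grow-new (suc j) (σ w) (heard (grow (suc j)) σ w) (trans (sym (right₂ sw)) eq)
    ... | inj₁ old                     = inj₁ old
    ... | inj₂ (_ , m≡ , p , h , par) =
      inj₂ (sym (suc-injective m≡) , p , par , proj₂ (proj₂ (proj₂ (heard-just (grow (suc j)) σ h))))

    fresh-right : ∀ {u w} → side u ≡ false → level (σ u) ≡ suc j → Adj G u w → level (σ w) ≡ 0 →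
                  level (σ₂ w) ≡ suc j
    fresh-right {u} {w} su lu e lw =
      let q , eq = portTo e
          sw = right-of e su
          p , h = heard-some (grow (suc j)) σ {u} {q} eq (right-≡ valid su , lu)
      in  trans (right₂ sw) (trans (cong (λ h → level (react (grow (suc j)) (σ w) h)) h)
                                   (grow-fresh (suc j) (σ w) p (right-≡ valid sw) lw))

    fresh-left : ∀ {w u} → side w ≡ true → level (σ₁ w) ≡ suc j → Points σ w u → level (σ u) ≡ 0 →
                 level (σ₂ u) ≡ suc (suc j)
    fresh-left {w} {u} sw lw pt@(q , m , eq) lu =
      let su = left-of (points-adj σ pt) sw
          p , h = heard-some (reply (suc j)) σ₁ {w} {q} eq (right-≡ valid sw , lw , m)
      in  trans (cong (λ h → level (react (reply (suc j)) (σ₁ u) h)) h)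
                (reply-fresh (suc j) (σ₁ u) p (right-≡ valid su) (trans (left₁ su) lu))

    layered : Layered (suc j) σ₂
    layered = record
      { free-root = λ sv eq → keep (free-root lay sv eq)
      ; root-free = λ sv eq → root-free′ sv eq
      ; from-mate = from-mate′
      ; from-parent = from-parent′
      ; to-mate = to-mate′
      ; closed = closed′
      ; bounded = bounded′
      }
      where
      root-free′ : ∀ {v} → side v ≡ false → level (σ₂ v) ≡ 1 → mate (σ v) ≡ nothing
      root-free′ sv eq with new-left sv eq
      ... | inj₁ old = root-free lay sv old
      from-mate′ : ∀ {v m} → side v ≡ false → level (σ₂ v) ≡ suc (suc m) →
                   ∃ λ w → Points σ v w × level (σ₂ w) ≡ suc m
      from-mate′ sv eq with new-left sv eq
      ... | inj₁ old = let w , pt , lw = from-mate lay sv old in w , pt , keep lw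
      ... | inj₂ (refl , w , pt , lw) = w , pt , keep₂ lw
      from-parent′ : ∀ {w m} → side w ≡ true → level (σ₂ w) ≡ suc m →
                     ∃ λ p → parent (σ₂ w) ≡ just p × level (σ₂ (nbr w p)) ≡ suc m
      from-parent′ sw eq with new-right sw eq
      ... | inj₁ (old , same) = let p , par , lp = from-parent lay sw old in p , trans same par , keep lp
      ... | inj₂ (refl , p , par , lp) = p , par , keep lp
      to-mate′ : ∀ {w m u} → side w ≡ true → level (σ₂ w) ≡ suc m → Points σ w u →
                 level (σ₂ u) ≡ suc (suc m)
      to-mate′ {w} {m} {u} sw eq pt with new-right sw eq
      ... | inj₁ (old , _) = keep (to-mate lay sw old pt)
      ... | inj₂ (refl , _) = by-level (level (σ u)) refl
        where
        su = left-of (points-adj σ pt) sw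
        by-level : ∀ l → level (σ u) ≡ l → level (σ₂ u) ≡ suc (suc m)
        by-level 0 lu = fresh-left sw (trans (sym (right₂ sw)) eq) pt lu
        by-level 1 lu = ⊥-elim (points⇒matched σ (paired valid pt) (root-free lay su lu))
        -- A left node beyond level 1 owes its level to its mate, which is `w`; so the level it
        -- already has is the required one.
        by-level (suc (suc k)) lu =
          let w′ , pt′ , lw′ = from-mate lay su lu
              w′≡w = points-unique σ pt′ (paired valid pt)
              k≡j = suc-injective (trans (sym (keep lw′)) (trans (cong (λ w → level (σ₂ w)) w′≡w) eq))
          in  keep (trans lu (cong (λ k → suc (suc k)) k≡j))
      closed′ : ∀ {u m w} → side u ≡ false → level (σ₂ u) ≡ suc m → m < suc j → Adj G u w →
                ∃ λ k → level (σ₂ w) ≡ suc k × k ≤ m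
      closed′ {u} {m} {w} su eq m<1+j e with new-left su eq
      ... | inj₂ (refl , _) = ⊥-elim (<-irrefl refl m<1+j)
      ... | inj₁ old with m≤n⇒m<n∨m≡n (s≤s⁻¹ m<1+j)
      ...   | inj₁ m<j  = let k , lw , k≤m = closed lay su old m<j e in k , keep lw , k≤m
      ...   | inj₂ refl = by-level (level (σ w)) refl
        where
        by-level : ∀ l → level (σ w) ≡ l → ∃ λ k → level (σ₂ w) ≡ suc k × k ≤ m
        by-level 0       lw = m , fresh-right su old e lw , ≤-refl
        -- A neighbour reached earlier has level at most `j`, which `bounded` supplies.
        by-level (suc k) lw = k , keep lw , <⇒≤ (bounded lay (right-of e su) lw)
      bounded′ : ∀ {w m} → side w ≡ true → level (σ₂ w) ≡ suc m → m < suc j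
      bounded′ sw eq with new-right sw eq
      ... | inj₁ (old , _)  = m<n⇒m<1+n (bounded lay sw old)
      ... | inj₂ (refl , _) = ≤-refl

  searched : ℕ → Config → Config
  searched j σ = run (search j) (act root σ)

  searched-suc : ∀ j σ → searched (suc j) σ ≡ explore (suc j) (searched j σ)
  searched-suc j σ = run-++ (search j) (grow (suc j) ∷ reply (suc j) ∷ []) (act root σ)

  searched-layered : ∀ j {σ} → Valid σ →
    let σ′ = searched j σ in Valid σ′ × Layered j σ′ × (∀ v → mate (σ′ v) ≡ mate (σ v))
  searched-layered zero    valid = root-valid valid , root-layered valid , λ _ → refl
  searched-layered (suc j) {σ} valid =
    let valid′ , lay , same = searched-layered j valid
    in  subst (λ σ′ → Valid σ′ × Layered (suc j) σ′ × (∀ v → mate (σ′ v) ≡ mate (σ v)))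
              (sym (searched-suc j σ))
              (explore-valid valid′ , Explore.layered valid′ lay , same)

  -- Moving holes towards the free left nodes

  exchange : ℕ → Config → Config
  exchange i σ = act claim (act (propose i) σ)

  -- The part of the layering that mentions no mates. Exchanges alter only mates, so it persists
  -- unchanged through a whole retraction.
  Parents : Config → Set
  Parents σ = ∀ {w m} → side w ≡ true → level (σ w) ≡ suc m →
              ∃ λ p → parent (σ w) ≡ just p × level (σ (nbr w p)) ≡ suc m

  module Exchange {σ} (valid : Valid σ) (i : ℕ) where
    σ₁ σ₂ : Config
    σ₁ = act (propose (suc i)) σ
    σ₂ = act claim σ₁

    Adopts : Fin n → Fin n → Set
    Adopts v w = Points σ₁ v w × side w ≡ true × level (σ w) ≡ suc i × mate (σ w) ≡ nothing ×
                 ∃ λ q → parent (σ w) ≡ just q × nbr w q ≡ v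

    propose-left : ∀ {v} → side v ≡ false → mate (σ₁ v) ≡ (heard (propose (suc i)) σ v <∣> mate (σ v))
    propose-left {v} sv = cong (if_then mate (σ v) else (heard (propose (suc i)) σ v <∣> mate (σ v)))
                               (right-≡ valid sv)

    adopts : ∀ {v p} → side v ≡ false → heard (propose (suc i)) σ v ≡ just p → Adopts v (nbr v p)
    adopts {v} {p} sv h =
      let q , eq , rw , lw , mw , par = heard-just (propose (suc i)) σ h
      in  (p , trans (propose-left sv) (cong (_<∣> mate (σ v)) h) , refl) ,
          trans (sym (sides valid _)) rw , lw , mw , q , par , eq

    left-cases : ∀ {v} → side v ≡ false → mate (σ₁ v) ≡ mate (σ v) ⊎ ∃ (Adopts v)
    left-cases {v} sv = by-heard (heard (propose (suc i)) σ v) refl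
      where
      by-heard : ∀ h → heard (propose (suc i)) σ v ≡ h → mate (σ₁ v) ≡ mate (σ v) ⊎ ∃ (Adopts v)
      by-heard nothing  h = inj₁ (trans (propose-left sv) (cong (_<∣> mate (σ v)) h))
      by-heard (just p) h = inj₂ (nbr v p , adopts sv h)

    points-cases : ∀ {v w} → side v ≡ false → Points σ₁ v w → Points σ v w ⊎ Adopts v w
    points-cases sv pt@(p , m , eq) with left-cases sv
    ... | inj₁ same     = inj₁ (p , trans (sym same) m , eq)
    ... | inj₂ (w′ , ad) = inj₂ (subst (Adopts _) (points-unique σ₁ (proj₁ ad) pt) ad)

    free-unpointed : ∀ {v w} {A : Set} → mate (σ w) ≡ nothing → Points σ v w → A
    free-unpointed mw pt = ⊥-elim (points⇒matched σ (paired valid pt) mw)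

    -- A right node proposes only to its one parent, and only while free, when no old pointer leads
    -- to it. Thus new pointers conflict neither with each other nor with old ones.
    injective : ∀ {u u′ w} → side u ≡ false → side u′ ≡ false →
                Points σ₁ u w → Points σ₁ u′ w → u ≡ u′
    injective su su′ pt pt′ with points-cases su pt | points-cases su′ pt′
    ... | inj₁ old | inj₁ old′ = points-injective valid old old′
    ... | inj₁ old | inj₂ (_ , _ , _ , mw , _) = free-unpointed mw old
    ... | inj₂ (_ , _ , _ , mw , _) | inj₁ old = free-unpointed mw old
    ... | inj₂ (_ , _ , _ , _ , q , par , eq) | inj₂ (_ , _ , _ , _ , q′ , par′ , eq′) =
      trans (sym eq) (trans (cong (nbr _) (just-injective (trans (sym par) par′))) eq′)

    valid₂ : Valid σ₂
    valid₂ = Claim.claim-valid {σ₁} (sides valid) (quiet valid) injective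

    left₂ : ∀ {v} → side v ≡ false → mate (σ₂ v) ≡ mate (σ₁ v)
    left₂ sv = claim-left σ₁ (right-≡ valid sv)

    matched₁ : ∀ {v} → side v ≡ false → mate (σ v) ≢ nothing → mate (σ₁ v) ≢ nothing
    matched₁ sv ≢n eq with left-cases sv
    ... | inj₁ same     = ≢n (trans (sym same) eq)
    ... | inj₂ (_ , ad) = points⇒matched σ₁ (proj₁ ad) eq

    saturated-mono : ∀ v → Saturated σ v → Saturated σ₂ v
    saturated-mono v (sv , ≢n) = sv , λ eq → matched₁ sv ≢n (trans (sym (left₂ sv)) eq)

    size-mono : size σ ≤ size σ₂
    size-mono = count-mono (saturated? σ) (saturated? σ₂) saturated-mono

    unclaimed : ∀ {w} → side w ≡ true → (∀ {u} → side u ≡ false → ¬ Points σ₁ u w) → mate (σ₂ w) ≡ nothing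
    unclaimed {w} sw none = by-mate (mate (σ₂ w)) refl
      where
      by-mate : ∀ m → mate (σ₂ w) ≡ m → mate (σ₂ w) ≡ nothing
      by-mate nothing  eq = eq
      by-mate (just p) eq =
        let ru , pt = claim-points⁻ σ₁ (right-≡ valid sw) (p , eq , refl)
        in  ⊥-elim (none (trans (sym (sides valid _)) ru) pt)

    stays-free : ∀ {w} → side w ≡ true → mate (σ w) ≡ nothing → level (σ w) ≢ suc i →
                 mate (σ₂ w) ≡ nothing
    stays-free sw mw ≢i = unclaimed sw λ su pt →
      [ free-unpointed mw , (λ ad → ≢i (proj₁ (proj₂ (proj₂ ad)))) ]′ (points-cases su pt)

    -- Only `u` pointed at `w`, and `u` now points at `w′`, which differs from `w` because it was
    -- free. As `w` had a mate, it made no proposal either, so nobody claims it.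
    released : ∀ {u w w′} → side u ≡ false → Points σ u w → Adopts u w′ → mate (σ₂ w) ≡ nothing
    released {u} {w} {w′} su pt (pt′ , _ , _ , mw′ , _) =
      unclaimed (right-of (points-adj σ pt) su) λ su″ pt″ → claimed su″ pt″ (points-cases su″ pt″)
      where
      claimed : ∀ {u″} → side u″ ≡ false → Points σ₁ u″ w → Points σ u″ w ⊎ Adopts u″ w → ⊥
      claimed su″ pt″ (inj₂ (_ , _ , _ , mw , _)) = free-unpointed mw pt
      claimed {u″} su″ pt″ (inj₁ old) =
        free-unpointed mw′ (subst (Points σ u) (points-unique σ₁ ptw pt′) pt)
        where
        ptw : Points σ₁ u w
        ptw = subst (λ x → Points σ₁ x w) (points-injective valid old pt) pt″

    -- The parent may accept a proposal other than that of `w`. That it accepts some proposal is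
    -- enough to pass the hole on.
    parent-adopts : Parents σ → ∀ {w} → side w ≡ true → mate (σ w) ≡ nothing → level (σ w) ≡ suc i →
                    ∃ λ u → side u ≡ false × level (σ u) ≡ suc i × ∃ (Adopts u)
    parent-adopts parents {w} sw mw lw =
      let q , par , lu = parents sw lw
          su = left-of (nbr-adj w q) sw
          p , h = heard-some (propose (suc i)) σ {w} {q} refl (right-≡ valid sw , lw , mw , par)
      in  nbr w q , su , lu , nbr (nbr w q) p , adopts su h

    adopts-level : Parents σ → ∀ {v w} → Adopts v w → level (σ v) ≡ suc i
    adopts-level parents {v} {w} (_ , sw , lw , _ , q , par , eq) =
      let q′ , par′ , lv = parents sw lw
          q′≡q = just-injective (trans (sym par′) par)
      in  trans (cong (λ u → level (σ u)) (trans (sym eq) (cong (nbr w) (sym q′≡q)))) lv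

    unchanged : Parents σ → ∀ {v} → side v ≡ false → level (σ v) ≢ suc i → mate (σ₂ v) ≡ mate (σ v)
    unchanged parents sv ≢i with left-cases sv
    ... | inj₁ same     = trans (left₂ sv) same
    ... | inj₂ (_ , ad) = ⊥-elim (≢i (adopts-level parents ad))

  -- What the exchanges at levels `i`, ..., 1 still need of the layering. An exchange changes the
  -- mates of left nodes at its own level only, so the layers below stay intact.
  record Ready (i : ℕ) (σ : Config) : Set where
    field
      root-free′ : ∀ {v} → 0 < i → side v ≡ false → level (σ v) ≡ 1 → mate (σ v) ≡ nothing
      from-mate′ : ∀ {v m} → suc m < i → side v ≡ false → level (σ v) ≡ suc (suc m) →
                   ∃ λ w → Points σ v w × level (σ w) ≡ suc m
      parents    : Parents σ

  open Ready

  Hole : ℕ → Config → Set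
  Hole i σ = ∃ λ w → ∃ λ m → side w ≡ true × mate (σ w) ≡ nothing × level (σ w) ≡ suc m × m < i

  layered⇒ready : ∀ {i j σ} → Layered j σ → Ready i σ
  layered⇒ready lay = record
    { root-free′ = λ _ → root-free lay ; from-mate′ = λ _ → from-mate lay ; parents = from-parent lay }

  exchange-ready : ∀ {i σ} → Valid σ → Ready (suc i) σ → Ready i (exchange (suc i) σ)
  exchange-ready {i} {σ} valid ready = record
    { root-free′ = λ 0<i sv lv →
        trans (unchanged (parents ready) sv (λ lv′ → <⇒≢ 0<i (suc-injective (trans (sym lv) lv′))))
              (root-free′ ready (s≤s z≤n) sv lv)
    ; from-mate′ = λ 1+m<i sv lv →
        let w , (p , mv , eq) , lw = from-mate′ ready (m<n⇒m<1+n 1+m<i) sv lv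
        in  w , (p , trans (unchanged (parents ready) sv
                              (λ lv′ → <⇒≢ 1+m<i (suc-injective (trans (sym lv) lv′)))) mv , eq) , lw
    ; parents = parents ready
    }
    where open Exchange valid i

  retract-valid : ∀ i {σ} → Valid σ → Valid (run (retract i) σ)
  retract-valid zero    valid = valid
  retract-valid (suc i) valid = retract-valid i (Exchange.valid₂ valid i)

  retract-mono : ∀ i {σ} → Valid σ → size σ ≤ size (run (retract i) σ)
  retract-mono zero    valid = ≤-refl
  retract-mono (suc i) valid =
    ≤-trans (Exchange.size-mono valid i) (retract-mono i (Exchange.valid₂ valid i))

  -- A free right node at level i takes over the mate of its parent, which frees a right
  -- node at level i − 1; at level 1 the parent is itself free.
  hole-moves : ∀ {i σ} → Valid σ → Ready (suc i) σ → Hole (suc i) σ →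
               Hole i (exchange (suc i) σ) ⊎ size σ < size (exchange (suc i) σ)
  hole-moves {i} {σ} valid ready (w , m , sw , mw , lw , m<1+i) with m≤n⇒m<n∨m≡n (s≤s⁻¹ m<1+i)
  ... | inj₁ m<i =
    inj₁ (w , m , sw , stays-free sw mw (λ lw′ → <⇒≢ m<i (suc-injective (trans (sym lw) lw′))) , lw , m<i)
    where open Exchange valid i
  hole-moves {zero} {σ} valid ready (w , .zero , sw , mw , lw , m<1+i) | inj₂ refl =
    let u , su , lu , w′ , ad = parent-adopts (parents ready) sw mw lw
    in  inj₂ (count-mono-< (saturated? σ) (saturated? σ₂) saturated-mono {u}
                (su , λ eq → points⇒matched σ₁ (proj₁ ad) (trans (sym (left₂ su)) eq))
                (λ sat → proj₂ sat (root-free′ ready (s≤s z≤n) su lu)))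
    where open Exchange valid 0
  hole-moves {suc i} {σ} valid ready (w , .(suc i) , sw , mw , lw , m<1+i) | inj₂ refl =
    let u , su , lu , w′ , ad = parent-adopts (parents ready) sw mw lw
        w₀ , pt , lw₀ = from-mate′ ready ≤-refl su lu
    in  inj₁ (w₀ , i , right-of (points-adj σ pt) su , released su pt ad , lw₀ , ≤-refl)
    where open Exchange valid (suc i)

  retract-augments : ∀ i {σ} → Valid σ → Ready i σ → Hole i σ → size σ < size (run (retract i) σ)
  retract-augments zero    valid ready (_ , _ , _ , _ , _ , ())
  retract-augments (suc i) valid ready hole with hole-moves valid ready hole
  ... | inj₁ hole′ = ≤-<-trans (Exchange.size-mono valid i)
                       (retract-augments i (Exchange.valid₂ valid i) (exchange-ready valid ready) hole′)
  ... | inj₂ more  = <-≤-trans more (retract-mono i (Exchange.valid₂ valid i))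

  -- Layer sizes against the deficiency of the matching

  record Reached (i : ℕ) (σ : Config) (v : Fin n) : Set where
    constructor reached
    field
      positive : 0 < level (σ v)
      within   : level (σ v) ≤ i

  reached? : ∀ i σ → Decidable (Reached i σ)
  reached? i σ v = map′ (λ (p , q) → reached p q) (λ (reached p q) → p , q)
                        (0 <? level (σ v) ×-dec level (σ v) ≤? i)

  reached-level : ∀ {i σ v} → Reached i σ v → ∃ λ m → level (σ v) ≡ suc m × m < i
  reached-level {σ = σ} {v} (reached 0<l l≤i) with level (σ v)
  ... | suc m = m , refl , l≤i

  level-reached : ∀ {i σ v m} → level (σ v) ≡ suc m → m < i → Reached i σ v
  level-reached lv m<i = reached (subst (0 <_) (sym lv) (s≤s z≤n)) (subst (_≤ _) (sym lv) m<i)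

  reachedRight? : ∀ i σ → Decidable (λ v → side v ≡ true × Reached i σ v)
  reachedRight? i σ v = side v ≟ᵇ true ×-dec reached? i σ v

  layer? : ∀ i (σ : Config) → Decidable (λ v → side v ≡ true × level (σ v) ≡ i)
  layer? i σ v = side v ≟ᵇ true ×-dec level (σ v) ≟ⁿ i

  layers-disjoint : ∀ k σ i → (∀ m → m < i → k ≤ count (layer? (suc m) σ)) →
                    i * k ≤ count (reachedRight? i σ)
  layers-disjoint k σ zero    large = z≤n
  layers-disjoint k σ (suc i) large =
    ≤-trans (+-mono-≤ (large i ≤-refl) (layers-disjoint k σ i (λ m m<i → large m (m<n⇒m<1+n m<i))))
      (count-⊎ (layer? (suc i) σ) (reachedRight? i σ) (reachedRight? (suc i) σ)
        (λ v (sv , lv) → sv , level-reached lv ≤-refl)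
        (λ v (sv , reached 0<l l≤i) → sv , reached 0<l (m≤n⇒m≤1+n l≤i))
        (λ v (_ , lv) (_ , reached _ l≤i) → <⇒≢ (s≤s l≤i) lv))

  module NoHole {j σ} (valid : Valid σ) (lay : Layered j σ) (noHole : ¬ Hole j σ) where

    right-matched : ∀ {w m} → side w ≡ true → level (σ w) ≡ suc m → mate (σ w) ≢ nothing
    right-matched sw lw mw = noHole (_ , _ , sw , mw , lw , bounded lay sw lw)

    left-unreached-matched : ∀ {i v} → side v ≡ false → ¬ Reached (suc i) σ v → mate (σ v) ≢ nothing
    left-unreached-matched sv ¬r mv = ¬r (level-reached (free-root lay sv mv) (s≤s z≤n))

    reached≤size : ∀ i → count (reachedRight? i σ) ≤ size σ
    reached≤size i = count-inj (reachedRight? i σ) (saturated? σ) (Points σ) image (points-injective valid)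
      where
      image : ∀ w → side w ≡ true × Reached i σ w → ∃ λ u → Saturated σ u × Points σ w u
      image w (sw , r) =
        let m , lw , _ = reached-level r
            u , pt = matched⇒points σ (right-matched sw lw)
        in  u , (left-of (points-adj σ pt) sw , points⇒matched σ (paired valid pt)) , pt

    layers≤size : ∀ k → (∀ m → m < j → k ≤ count (layer? (suc m) σ)) → j * k ≤ size σ
    layers≤size k large = ≤-trans (layers-disjoint k σ j large) (reached≤size j)

    -- The left nodes outside layers 1, …, m + 1 and the right nodes inside them cover all
    -- edges, and all of them but the right layer m + 1 inject into the matching; hence
    -- every right layer is at least as large as the deficiency of the matching.
    module Cut (m : ℕ) (m<j : m < j) where
      InCut : Fin n → Set
      InCut v = (side v ≡ false × ¬ Reached (suc m) σ v) ⊎ (side v ≡ true × Reached (suc m) σ v)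

      inCut? : Decidable InCut
      inCut? v = (side v ≟ᵇ false ×-dec ¬? (reached? (suc m) σ v)) ⊎-dec
                 (side v ≟ᵇ true ×-dec reached? (suc m) σ v)

      cut : Subset n
      cut = select inCut?

      cut-covers-left : ∀ {u v} → side u ≡ false → Adj G u v → u ∈ cut ⊎ v ∈ cut
      cut-covers-left {u} {v} su e = by-reached (reached? (suc m) σ u)
        where
        by-reached : Dec (Reached (suc m) σ u) → u ∈ cut ⊎ v ∈ cut
        by-reached (no ¬r) = inj₁ (∈-select⁺ inCut? (inj₁ (su , ¬r)))
        by-reached (yes r) =
          let m′ , lu , m′<1+m = reached-level r
              k , lv , k≤m′ = closed lay su lu (<-≤-trans m′<1+m m<j) e
          in  inj₂ (∈-select⁺ inCut? (inj₂ (right-of e su , level-reached lv (≤-<-trans k≤m′ m′<1+m))))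

      cut-covers : IsVertexCover G cut
      cut-covers {u} {v} e = by-side (side u) refl
        where
        by-side : ∀ b → side u ≡ b → u ∈ cut ⊎ v ∈ cut
        by-side false su = cut-covers-left su e
        by-side true  su = swap (cut-covers-left (left-of e su) (symm G e))

      Inner : Fin n → Set
      Inner v = (side v ≡ false × ¬ Reached (suc m) σ v) ⊎ (side v ≡ true × Reached m σ v)

      inner? : Decidable Inner
      inner? v = (side v ≟ᵇ false ×-dec ¬? (reached? (suc m) σ v)) ⊎-dec
                 (side v ≟ᵇ true ×-dec reached? m σ v)

      inner≤size : count inner? ≤ size σ
      inner≤size = count-inj inner? (saturated? σ) Image image injective
        where
        Image : Fin n → Fin n → Set
        Image v u = (¬ Reached (suc m) σ v × u ≡ v) ⊎ (Reached (suc m) σ u × Points σ v u)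
        image : ∀ v → Inner v → ∃ λ u → Saturated σ u × Image v u
        image v (inj₁ (sv , ¬r)) = v , (sv , left-unreached-matched sv ¬r) , inj₁ (¬r , refl)
        image v (inj₂ (sv , r)) =
          let k , lv , k<m = reached-level r
              u , pt = matched⇒points σ (right-matched sv lv)
          in  u , (left-of (points-adj σ pt) sv , points⇒matched σ (paired valid pt)) ,
              -- The mate is one level further, hence still within `m + 1`, and does not clash with
              -- an unreached left node mapped to itself.
              inj₂ (level-reached (to-mate lay sv lv pt) (s≤s k<m) , pt)
        injective : ∀ {v v′ u} → Image v u → Image v′ u → v ≡ v′
        injective (inj₁ (_ , refl))  (inj₁ (_ , refl))  = refl
        injective (inj₁ (¬r , refl)) (inj₂ (r , _))     = ⊥-elim (¬r r)
        injective (inj₂ (r , _))     (inj₁ (¬r , refl)) = ⊥-elim (¬r r)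
        injective (inj₂ (_ , pt))    (inj₂ (_ , pt′))   = points-injective valid pt pt′

      cut-size : ∣ cut ∣ ≤ size σ + count (layer? (suc m) σ)
      cut-size = ≤-trans (≤-reflexive (∣∣≡count cut))
        (≤-trans (count-∪ (_∈? cut) inner? (layer? (suc m) σ) (λ v v∈ → split (∈-select⁻ inCut? v∈)))
                 (+-monoˡ-≤ _ inner≤size))
        where
        split : ∀ {v} → InCut v → Inner v ⊎ (side v ≡ true × level (σ v) ≡ suc m)
        split (inj₁ left) = inj₁ (inj₁ left)
        split (inj₂ (sv , reached 0<l l≤1+m)) with m≤n⇒m<n∨m≡n l≤1+m
        ... | inj₁ l<1+m = inj₁ (inj₂ (sv , reached 0<l (s≤s⁻¹ l<1+m)))
        ... | inj₂ l≡1+m = inj₂ (sv , l≡1+m)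

  phase-≡ : ∀ j σ → run (phase j) σ ≡ run (retract j) (searched j σ)
  phase-≡ j σ = run-++ (search j) (retract j) (act root σ)

  size-cong : ∀ σ σ′ → (∀ v → mate (σ′ v) ≡ mate (σ v)) → size σ ≤ size σ′
  size-cong σ σ′ same = count-mono (saturated? σ) (saturated? σ′)
    (λ v (sv , ≢n) → sv , λ eq → ≢n (trans (sym (same v)) eq))

  -- Number and depth of the phases

  module Optimum {opt : ℕ} (S₀ : Subset n) (cov₀ : IsVertexCover G S₀) (∣S₀∣≤opt : ∣ S₀ ∣ ≤ opt)
                 (least : ∀ S → IsVertexCover G S → opt ≤ ∣ S ∣) where

    size≤opt : ∀ {σ} → Valid σ → size σ ≤ opt
    size≤opt valid = ≤-trans (size≤cover valid S₀ cov₀) ∣S₀∣≤opt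

    -- Without a hole, `j` disjoint layers of at least `k` matched nodes would exceed `opt`. The
    -- double negation avoids deciding `Hole`; `phase-augments` decides the comparison of sizes
    -- instead.
    hole-exists : ∀ {j σ k} → Valid σ → Layered j σ → size σ + k ≤ opt → opt < j * k → ¬ ¬ Hole j σ
    hole-exists {j} {σ} {k} valid lay deficient opt<jk noHole =
      <⇒≱ opt<jk (≤-trans (layers≤size k large) (size≤opt valid))
      where
      open NoHole valid lay noHole
      large : ∀ m → m < j → k ≤ count (layer? (suc m) σ)
      large m m<j = +-cancelˡ-≤ (size σ) _ _
        (≤-trans deficient (≤-trans (least cut cut-covers) cut-size))
        where open Cut m m<j

    phase-valid : ∀ j {σ} → Valid σ → Valid (run (phase j) σ)
    phase-valid j {σ} valid = subst Valid (sym (phase-≡ j σ))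
      (retract-valid j (proj₁ (searched-layered j valid)))

    phase-mono : ∀ j {σ} → Valid σ → size σ ≤ size (run (phase j) σ)
    phase-mono j {σ} valid =
      let valid′ , lay , same = searched-layered j valid
      in  subst (λ σ′ → size σ ≤ size σ′) (sym (phase-≡ j σ))
            (≤-trans (size-cong σ (searched j σ) same) (retract-mono j valid′))

    phase-augments : ∀ {j σ k} → Valid σ → size σ + k ≤ opt → opt < j * k →
                     size σ < size (run (phase j) σ)
    phase-augments {j} {σ} {k} valid deficient opt<jk with size σ <? size (run (phase j) σ)
    ... | yes more = more
    ... | no ¬more =
      let valid′ , lay , same = searched-layered j valid
          size′≤ = size-cong (searched j σ) σ (λ v → sym (same v))
      in  ⊥-elim (hole-exists valid′ lay (≤-trans (+-monoˡ-≤ k size′≤) deficient) opt<jk λ hole →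
            ¬more (subst (λ σ′ → size σ < size σ′) (sym (phase-≡ j σ))
              (≤-<-trans (size-cong σ (searched j σ) same)
                         (retract-augments j valid′ (layered⇒ready lay) hole))))

    -- The `r` phases left are a budget for the deficiency in excess of `k`: a phase either adds an
    -- edge, or the deficiency is below `k` already and remains so.
    phases : ∀ r {j σ k} → opt < j * k → Valid σ → opt < size σ + (k + r) →
             let σ′ = run (repeat r (phase j)) σ in Valid σ′ × opt < size σ′ + k
    phases zero {σ = σ} {k} opt<jk valid bound =
      valid , subst (λ x → opt < size σ + x) (+-identityʳ k) bound
    phases (suc r) {j} {σ} {k} opt<jk valid bound =
      subst (λ σ′ → Valid σ′ × opt < size σ′ + k) (sym (run-++ (phase j) (repeat r (phase j)) σ))
            (phases r {j} {run (phase j) σ} opt<jk (phase-valid j valid) next)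
      where
      σ₁ = run (phase j) σ
      next : opt < size σ₁ + (k + r)
      next with size σ + k ≤? opt
      ... | yes deficient = <-≤-trans bound (≤-trans (≤-reflexive
              (trans (cong (size σ +_) (+-suc k r)) (+-suc (size σ) (k + r))))
              (+-monoˡ-≤ (k + r) (phase-augments {j} {σ} {k} valid deficient opt<jk)))
      ... | no ¬deficient = <-≤-trans (≰⇒> ¬deficient)
              (+-mono-≤ (phase-mono j valid) (m≤m+n k r))

    -- The product is `2 ^ (a + b) + 2 ^ a`; the extra layer in the depth makes the inequality
    -- strict.
    deep : ∀ a b → opt ≤ 2 ^ (a + b) → opt < suc (2 ^ b) * 2 ^ a
    deep a b opt≤ = ≤-<-trans opt≤ (<-≤-trans (m<n+m (2 ^ (a + b)) (m^n>0 2 a))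
      (≤-reflexive (cong (2 ^ a +_) (trans (^-distribˡ-+-* 2 a b) (*-comm (2 ^ a) (2 ^ b))))))

    scheduled : ∀ a b {σ} → opt ≤ 2 ^ (a + b) → Valid σ → opt < size σ + 2 ^ suc a →
                let σ′ = run (schedule a b) σ in Valid σ′ × opt ≤ size σ′
    scheduled zero    b {σ} opt≤ valid bound =
      let valid′ , bound′ = phases 1 {suc (2 ^ b)} {σ} {1} (deep 0 b opt≤) valid bound
      in  valid′ , s≤s⁻¹ (subst (opt <_) (+-comm (size (run (schedule 0 b) σ)) 1) bound′)
    scheduled (suc a) b {σ} opt≤ valid bound =
      let valid′ , bound′ = phases (2 ^ suc a) {suc (2 ^ b)} {σ} {2 ^ suc a} (deep (suc a) b opt≤) valid
                              (subst (λ x → opt < size σ + (2 ^ suc a + x)) (+-identityʳ (2 ^ suc a)) bound)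
      in  subst (λ σ′ → Valid σ′ × opt ≤ size σ′)
                (sym (run-++ (repeat (2 ^ suc a) (phase (suc (2 ^ b)))) (schedule a (suc b)) σ))
                (scheduled a (suc b) (subst (λ x → opt ≤ 2 ^ x) (sym (+-suc a b)) opt≤) valid′ bound′)

  -- König's cover passes the local checks

  inCover-≡ : ∀ {d} (x : Local d) {b k} → right x ≡ b → level x ≡ k → inCover x ≡ (b xor (k ≡ᵇ 0))
  inCover-≡ x = cong₂ (λ b k → b xor (k ≡ᵇ 0))

  uncovered-quiet⁺ : ∀ σ {v} → Quiet σ v →
    (∀ {u} → Adj G v u → inCover (σ v) ≡ true ⊎ inCover (σ u) ≡ true) → Quiet (act uncovered σ) v
  uncovered-quiet⁺ σ {v} q covered =
    cong₂ _∨_ q (satisfied (inCover (σ v)) (heard uncovered σ v) refl refl)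
    where
    satisfied : ∀ b h → inCover (σ v) ≡ b → heard uncovered σ v ≡ h → (not b ∧ is-just h) ≡ false
    satisfied true  h        _  _ = refl
    satisfied false nothing  _  _ = refl
    satisfied false (just p) cv h =
      let _ , _ , cu = heard-just uncovered σ h
      in  [ (λ cv′ → trans (sym cv′) cv) , (λ cu′ → trans (sym cu′) cu) ]′ (covered (nbr-adj v p))

  confirms-refl : ∀ {d} (p : Fin d) → confirms (just p) (just p) ≡ true
  confirms-refl p = trans (isYes≗does (p ≟ᶠ p)) (dec-true (p ≟ᶠ p) refl)

  unmated-quiet⁺ : ∀ {σ} → Valid σ → ∀ {v} →
    (inCover (σ v) ≡ true → ∃ λ u → Points σ v u × inCover (σ u) ≡ false) → Quiet (act unmated σ) v
  unmated-quiet⁺ {σ} valid {v} mated = cong₂ _∨_ (quiet valid v) (satisfied (inCover (σ v)) refl)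
    where
    satisfied : ∀ b → inCover (σ v) ≡ b → (b ∧ not (confirms (mate (σ v)) (heard unmated σ v))) ≡ false
    satisfied false _  = refl
    satisfied true  cv =
      let u , pt@(p , m , eq) , cu = mated cv
          q , m′ , eq′ = paired valid pt
          p′ , h = heard-some unmated σ {u} {q} eq′ (cu , m′)
          q″ , eq″ , _ , m″ = heard-just unmated σ h
          nbr≡u = points-unique σ (paired valid (q″ , m″ , eq″)) pt
          p′≡p = nbr-injective v (trans nbr≡u (sym eq))
      in  cong not (trans (cong₂ confirms m (trans h (cong just p′≡p))) (confirms-refl p))

  -- If no right node has the last level `j`, no left node has level `j + 1`, so `closed` applies to
  -- every reached left node: the search was exhaustive, and König's argument goes through.
  module Verified {j τ} (valid : Valid τ) (lay : Layered j τ) (noHole : ¬ Hole j τ) (0<j : 0 < j)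
                  (noTop : ∀ {w} → side w ≡ true → level (τ w) ≢ j) where
    open NoHole valid lay noHole

    covered-left : ∀ {v u} → side v ≡ false → Adj G v u → inCover (τ v) ≡ true ⊎ inCover (τ u) ≡ true
    covered-left {v} {u} sv e = by-level (level (τ v)) refl
      where
      Goal = inCover (τ v) ≡ true ⊎ inCover (τ u) ≡ true
      reached-right : ∀ {m} → level (τ v) ≡ suc m → m < j → Goal
      reached-right lv m<j =
        let k , lu , _ = closed lay sv lv m<j e
        in  inj₂ (inCover-≡ (τ u) (right-≡ valid (right-of e sv)) lu)
      by-level : ∀ l → level (τ v) ≡ l → Goal
      by-level 0             lv = inj₁ (inCover-≡ (τ v) (right-≡ valid sv) lv)
      by-level 1             lv = reached-right lv 0<j
      by-level (suc (suc m)) lv =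
        let w , pt , lw = from-mate lay sv lv
            sw = right-of (points-adj τ pt) sv
        in  reached-right lv (≤∧≢⇒< (bounded lay sw lw) (λ 1+m≡j → noTop sw (trans lw 1+m≡j)))

    covered : ∀ {v u} → Adj G v u → inCover (τ v) ≡ true ⊎ inCover (τ u) ≡ true
    covered {v} {u} e = by-side (side v) refl
      where
      by-side : ∀ b → side v ≡ b → inCover (τ v) ≡ true ⊎ inCover (τ u) ≡ true
      by-side false sv = covered-left sv e
      by-side true  sv = swap (covered-left (left-of e sv) (symm G e))

    mated : ∀ {v} → inCover (τ v) ≡ true → ∃ λ u → Points τ v u × inCover (τ u) ≡ false
    mated {v} cv = by-side (side v) (level (τ v)) refl refl
      where
      Goal = ∃ λ u → Points τ v u × inCover (τ u) ≡ false
      contradictory : ∀ {b k} → side v ≡ b → level (τ v) ≡ k → (b xor (k ≡ᵇ 0)) ≡ false → Goal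
      contradictory sv lv eq with trans (sym cv) (trans (inCover-≡ (τ v) (right-≡ valid sv) lv) eq)
      ... | ()
      by-side : ∀ b k → side v ≡ b → level (τ v) ≡ k → Goal
      by-side false (suc m) sv lv = contradictory sv lv refl
      by-side true  0       sv lv = contradictory sv lv refl
      by-side true  (suc m) sv lv =
        let u , pt = matched⇒points τ (right-matched sv lv)
        in  u , pt , inCover-≡ (τ u) (right-≡ valid (left-of (points-adj τ pt) sv)) (to-mate lay sv lv pt)
      by-side false 0       sv lv =
        let u , pt = matched⇒points τ (λ mv → 0≢1+n (trans (sym lv) (free-root lay sv mv)))
            su = right-of (points-adj τ pt) sv
        in  u , pt , inCover-≡ (τ u) (right-≡ valid su) (unreached u pt su (level (τ u)) refl)
        where
        unreached : ∀ u → Points τ v u → side u ≡ true → ∀ k → level (τ u) ≡ k → level (τ u) ≡ 0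
        unreached u pt su 0       lu = lu
        -- A reached right node would have reached its mate `v`, whose level is 0.
        unreached u pt su (suc k) lu = ⊥-elim (0≢1+n (trans (sym lv) (to-mate lay su lu (paired valid pt))))

    uncovered-valid : Valid (act uncovered τ)
    uncovered-valid = record
      { sides = sides valid ; quiet = λ v → uncovered-quiet⁺ τ (quiet valid v) covered ; paired = paired valid }

    verify-quiet : ∀ v → Quiet (run verify τ) v
    verify-quiet v = unmated-quiet⁺ uncovered-valid {v} mated

  count-positive : ∀ {P : Pred (Fin n) 0ℓ} (P? : Decidable P) {v} → P v → 0 < count P?
  count-positive P? p = ≤-trans (s≤s z≤n) (count-delete P? p)

  -- From a right node, its parent and then the mate of the parent lead one right layer down. So a
  -- single node at level `j` populates all `j` layers, which is too many for `opt`.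
  layer-below : ∀ {j τ} → Layered j τ → ∀ {m k} → m ≤ k →
                (∃ λ w → side w ≡ true × level (τ w) ≡ suc k) → ∃ λ w → side w ≡ true × level (τ w) ≡ suc m
  layer-below lay {m} {zero}  z≤n top = top
  layer-below {τ = τ} lay {m} {suc k} m≤1+k top@(w , sw , lw) with m≤n⇒m<n∨m≡n m≤1+k
  ... | inj₂ refl = top
  ... | inj₁ m<1+k =
    let p , _ , lu = from-parent lay sw lw
        su = left-of (nbr-adj w p) sw
        w′ , pt , lw′ = from-mate lay su lu
    in  layer-below lay (s≤s⁻¹ m<1+k) (w′ , right-of (points-adj τ pt) su , lw′)

  module _ {opt : ℕ} (S₀ : Subset n) (cov₀ : IsVertexCover G S₀) (∣S₀∣≤opt : ∣ S₀ ∣ ≤ opt)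
           (least : ∀ S → IsVertexCover G S → opt ≤ ∣ S ∣) where
    open Optimum S₀ cov₀ ∣S₀∣≤opt least

    matching-quiet : ∀ s {σ} → opt ≤ 2 ^ s → Valid σ → ∀ v → Quiet (run verify (run (matching s) σ)) v
    matching-quiet s {σ} opt≤ valid v =
      subst (λ σ′ → Quiet (run verify σ′) v) (sym (run-++ (schedule s 0) (root ∷ search j) σ))
            (Verified.verify-quiet valid₂ lay noHole (s≤s z≤n) noTop v)
      where
      j = suc (2 ^ s)
      σ₁ = run (schedule s 0) σ
      result : Valid σ₁ × opt ≤ size σ₁
      result = scheduled s 0 (subst (λ k → opt ≤ 2 ^ k) (sym (+-identityʳ s)) opt≤) valid
        (≤-<-trans opt≤ (<-≤-trans (^-monoʳ-< 2 ≤-refl (n<1+n s)) (m≤n+m (2 ^ suc s) (size σ))))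
      τ = searched j σ₁
      valid₂ : Valid τ
      valid₂ = proj₁ (searched-layered j (proj₁ result))
      lay : Layered j τ
      lay = proj₁ (proj₂ (searched-layered j (proj₁ result)))
      noHole : ¬ Hole j τ
      -- The retraction here is hypothetical and not part of the schedule: it would enlarge a
      -- matching that already has size `opt`.
      noHole hole = <⇒≱ (retract-augments j valid₂ (layered⇒ready lay) hole)
        (≤-trans (size≤opt (retract-valid j valid₂))
          (≤-trans (proj₂ result) (size-cong σ₁ τ (proj₂ (proj₂ (searched-layered j (proj₁ result)))))))
      noTop : ∀ {w} → side w ≡ true → level (τ w) ≢ j
      -- Otherwise `2 ^ s + 1` nonempty layers of matched nodes would fit into a matching of size at
      -- most `opt`.
      noTop {w} sw lw = <⇒≱ (s≤s opt≤)
        (≤-trans (≤-reflexive (sym (*-identityʳ j)))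
          (≤-trans (NoHole.layers≤size valid₂ lay noHole 1 large) (size≤opt valid₂)))
        where
        large : ∀ m → m < j → 1 ≤ count (layer? (suc m) τ)
        large m m<j = let _ , member = layer-below lay (s≤s⁻¹ m<j) (w , sw , lw)
                      in  count-positive (layer? (suc m) τ) member

-- Success once the guess is large enough

module Convergence {c n : ℕ} (N : Network c n) where
  open Semantics N

  walk? : ∀ v m w → Dec (Walk v m w)
  walk? v zero w = map′ (λ { refl → here }) (λ { here → refl }) (v ≟ᶠ w)
  walk? v (suc m) w = map′ [ (λ { refl → here }) , (λ (_ , a , e) → a ▸ e) ]′ last-edge
    (v ≟ᶠ w ⊎-dec any? (λ u → walk? v m u ×-dec T? (adj G u w)))
    where
    last-edge : Walk v (suc m) w → v ≡ w ⊎ ∃ λ u → Walk v m u × Adj G u w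
    last-edge here    = inj₁ refl
    last-edge (a ▸ e) = inj₂ (_ , a , e)

  module Radius (S : Subset n) (cov : IsVertexCover G S) (v : Fin n) where
    inBall? : ∀ m → Decidable (λ w → w ∈ S × Walk v m w)
    inBall? m w = w ∈? S ×-dec walk? v m w

    -- An edge leaving the ball of radius m + 1 has an endpoint in S, and neither of its
    -- endpoints lies in the ball of radius m.
    closed-or-grows : ∀ m → (∀ {w} → Walk v (suc (suc m)) w → Walk v (suc m) w) ⊎
                            count (inBall? m) < count (inBall? (suc (suc m)))
    closed-or-grows m with any? (λ w → walk? v (suc (suc m)) w ×-dec ¬? (walk? v (suc m) w))
    ... | no none = inj₁ λ {w} a → decidable-stable (walk? v (suc m) w) (λ ¬b → none (w , a , ¬b))
    ... | yes (w , here , ¬b)  = ⊥-elim (¬b here)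
    ... | yes (w , a ▸ e , ¬b) = inj₂ ([ (λ u∈S → grows (u∈S , walk-mono (n≤1+n _) a) (λ b → ¬b (b ▸ e)))
                                       , (λ w∈S → grows (w∈S , a ▸ e) (λ b → ¬b (walk-mono (n≤1+n m) b))) ]′
                                       (cov e))
      where
      grows : ∀ {x} → x ∈ S × Walk v (suc (suc m)) x → ¬ Walk v m x →
              count (inBall? m) < count (inBall? (suc (suc m)))
      grows new ¬old = count-mono-< (inBall? m) (inBall? (suc (suc m)))
        (λ _ (x∈S , b) → x∈S , walk-mono (≤-trans (n≤1+n m) (n≤1+n (suc m))) b) new (λ (_ , b) → ¬old b)

    closed⇒all : ∀ {k} → (∀ {w} → Walk v (suc k) w → Walk v k w) → ∀ {m w} → Walk v m w → Walk v k w
    closed⇒all closed here    = here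
    closed⇒all closed (a ▸ e) = closed (closed⇒all closed a ▸ e)

    -- Every two further steps capture another node of `S` until the ball stops growing. With `i`
    -- beyond the size of `S` growth has ended, whence the factor 2 and the `suc` in `radius`.
    all-or-large : ∀ i → (∀ {m w} → Walk v m w → Walk v (i * 2) w) ⊎ i ≤ count (inBall? (i * 2))
    all-or-large zero = inj₂ z≤n
    all-or-large (suc i) with all-or-large i
    ... | inj₁ all = inj₁ λ a → walk-mono (m≤n+m (i * 2) 2) (all a)
    ... | inj₂ i≤ with closed-or-grows (i * 2)
    ...   | inj₁ closed = inj₁ λ a → walk-mono (n≤1+n _) (closed⇒all closed a)
    ...   | inj₂ grows  = inj₂ (≤-<-trans i≤ grows)

    within-radius : ∀ s → ∣ S ∣ ≤ 2 ^ s → ∀ {m w} → Walk v m w → Walk v (radius s) w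
    within-radius s ∣S∣≤ a with all-or-large (suc (2 ^ s))
    ... | inj₁ all   = walk-mono (≤-reflexive (*-comm (suc (2 ^ s)) 2)) (all a)
    ... | inj₂ large = ⊥-elim (<⇒≱ large (≤-trans
      (count-mono (inBall? (suc (2 ^ s) * 2)) (_∈? S) (λ _ → proj₁))
      (≤-trans (≤-reflexive (sym (∣∣≡count S))) ∣S∣≤)))

  module _ (bipartite : Bipartite G) (S : Subset n) (min : IsMinimumVertexCover G S)
           (s : ℕ) (∣S∣≤ : ∣ S ∣ ≤ 2 ^ s) where
    open Knows

    cov : IsVertexCover G S
    cov {u} {v} = proj₁ min {u} {v}

    -- The leader of `v` lies in the component of `u`, hence within the flooding radius of `u`,
    -- which has therefore heard of it.
    best-below : ∀ {v u} → Adj G v u → best (flooded s u) ⊑ best (flooded s v)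
    best-below {v} {u} e = subst (best (flooded s u) ⊑_) (sym (elected (flooded-knows s v)))
      (flooded-lowest s u (Radius.within-radius S cov _ s ∣S∣≤ (path (flooded-knows s v) ▸ e)))

    best-adj : ∀ {v u} → Adj G v u → best (flooded s u) ≡ best (flooded s v)
    best-adj e = ⊑-antisym (best-below e) (best-below (symm G e))

    right-adj : ∀ {v u} → Adj G v u → right (flooded s u) ≡ not (right (flooded s v))
    right-adj {v} {u} e =
      let side , proper = bipartite
          kv = flooded-knows s v
          ku = flooded-knows s u
          same = ident-inj N (trans (sym (elected ku)) (trans (best-adj e) (elected kv)))
      in  trans (parity ku side proper)
            (trans (cong (λ ℓ → side ℓ xor side u) same)
              (trans (sym (xor-flip (side (leader kv)) (side v) (side u) (proper e)))
                     (cong not (sym (parity kv side proper)))))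

    -- The matching is analysed with the computed parity, on which the nodes act; it may differ from
    -- the given bipartition by a swap in each component.
    side : Fin n → Bool
    side v = right (agreed s v)

    side-proper : Proper side
    side-proper {u} {v} e eq = not-¬ eq (right-adj (symm G e))

    agreed-valid : Matching.Valid N side side-proper (agreed s)
    agreed-valid = record
      { sides  = λ _ → refl
      ; quiet  = λ v → agree-quiet⁺ (flooded s) (λ e → best-adj e , right-adj e)
      ; paired = λ { {v} (p , m , _) → ⊥-elim (just≢nothing m (flooded-mate s v)) }
      }

    final-quiet : ∀ v → Quiet (final s) v
    final-quiet v = final-quiet⁺ s λ {w} _ →
      Matching.matching-quiet N side side-proper S cov ≤-refl (proj₂ min) s ∣S∣≤ agreed-valid w

-- Running time

length-search : ∀ j → length (search j) ≡ 2 * j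
length-search zero    = refl
length-search (suc j) = trans (length-++ (search j)) (trans (cong (_+ 2) (length-search j))
  (trans (+-comm (2 * j) 2) (sym (*-suc 2 j))))

length-retract : ∀ j → length (retract j) ≡ 2 * j
length-retract zero    = refl
length-retract (suc j) = trans (cong (2 +_) (length-retract j)) (sym (*-suc 2 j))

length-phase : ∀ j → length (phase j) ≡ suc (4 * j)
length-phase j = cong suc (trans (length-++ (search j))
  (trans (cong₂ _+_ (length-search j) (length-retract j)) (sym (*-distribʳ-+ j 2 2))))

length-repeat : ∀ k is → length (repeat k is) ≡ k * length is
length-repeat zero    is = refl
length-repeat (suc k) is = trans (length-++ is) (cong (length is +_) (length-repeat k is))

-- A phase of depth `2 ^ b + 1` takes `4 * 2 ^ b + 5` rounds, and 5 is at most `5 * 2 ^ b`; this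
-- gives the 9.
length-block : ∀ a b → length (repeat (2 ^ a) (phase (suc (2 ^ b)))) ≤ 9 * 2 ^ (a + b)
length-block a b = begin
  length (repeat (2 ^ a) (phase (suc (2 ^ b))))  ≡⟨ length-repeat (2 ^ a) (phase (suc (2 ^ b))) ⟩
  2 ^ a * length (phase (suc (2 ^ b)))           ≡⟨ cong (2 ^ a *_) (length-phase (suc (2 ^ b))) ⟩
  2 ^ a * suc (4 * suc (2 ^ b))                  ≡⟨ solve 2 (λ x y → x :* (con 1 :+ con 4 :* (con 1 :+ y))
                                                                    := con 5 :* (x :* con 1) :+ con 4 :* (x :* y))
                                                         refl (2 ^ a) (2 ^ b) ⟩
  5 * (2 ^ a * 1) + 4 * (2 ^ a * 2 ^ b)          ≤⟨ +-monoˡ-≤ _ (*-monoʳ-≤ 5 (*-monoʳ-≤ (2 ^ a) (m^n>0 2 b))) ⟩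
  5 * (2 ^ a * 2 ^ b) + 4 * (2 ^ a * 2 ^ b)      ≡⟨ *-distribʳ-+ (2 ^ a * 2 ^ b) 5 4 ⟨
  9 * (2 ^ a * 2 ^ b)                            ≡⟨ cong (9 *_) (^-distribˡ-+-* 2 a b) ⟨
  9 * 2 ^ (a + b)                                ∎

-- Halving the number of phases doubles their depth, so `a + b` is constant and all `suc a` blocks
-- have the same bound.
length-schedule : ∀ a b → length (schedule a b) ≤ suc a * (9 * 2 ^ (a + b))
length-schedule zero    b = ≤-trans (length-block 0 b) (≤-reflexive (sym (*-identityˡ (9 * 2 ^ b))))
length-schedule (suc a) b = begin
  length (repeat (2 ^ suc a) (phase (suc (2 ^ b))) ++ schedule a (suc b))
    ≡⟨ length-++ (repeat (2 ^ suc a) (phase (suc (2 ^ b)))) ⟩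
  length (repeat (2 ^ suc a) (phase (suc (2 ^ b)))) + length (schedule a (suc b))
    ≤⟨ +-mono-≤ (length-block (suc a) b) (length-schedule a (suc b)) ⟩
  9 * 2 ^ (suc a + b) + suc a * (9 * 2 ^ (a + suc b))
    ≡⟨ cong (λ e → 9 * 2 ^ (suc a + b) + suc a * (9 * 2 ^ e)) (+-suc a b) ⟩
  suc (suc a) * (9 * 2 ^ (suc a + b)) ∎

length-matching : ∀ s → length (matching s) ≤ suc s * (9 * 2 ^ s) + suc (2 * suc (2 ^ s))
length-matching s = begin
  length (schedule s 0 ++ root ∷ search (suc (2 ^ s)))
    ≡⟨ length-++ (schedule s 0) ⟩
  length (schedule s 0) + suc (length (search (suc (2 ^ s))))
    ≤⟨ +-mono-≤ (length-schedule s 0) (≤-reflexive (cong suc (length-search (suc (2 ^ s))))) ⟩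
  suc s * (9 * 2 ^ (s + 0)) + suc (2 * suc (2 ^ s))
    ≡⟨ cong (λ e → suc s * (9 * 2 ^ e) + suc (2 * suc (2 ^ s))) (+-identityʳ s) ⟩
  suc s * (9 * 2 ^ s) + suc (2 * suc (2 ^ s)) ∎

-- The 29 is 9 + 8 + 12: the schedule contributes 9, and all other rounds amount to
-- `8 * 2 ^ s + 12`.
length-stage : ∀ s → length (stage s) ≤ 29 * (suc s * 2 ^ s)
length-stage s = begin
  length (stage s)
    ≡⟨ length-++ (replicate R flood) ⟩
  length (replicate R flood) + suc (length (map signal (matching s ++ verify ++ spreads)))
    ≡⟨ cong₂ (λ x y → x + suc y) (length-replicate R)
         (trans (length-map signal (matching s ++ verify ++ spreads)) (length-++ (matching s))) ⟩
  R + suc (length (matching s) + suc (suc (length spreads)))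
    ≡⟨ cong (λ x → R + suc (length (matching s) + suc (suc x))) (length-replicate (2 * R)) ⟩
  R + suc (length (matching s) + suc (suc (2 * R)))
    ≤⟨ +-monoʳ-≤ R (s≤s (+-monoˡ-≤ (suc (suc (2 * R))) (length-matching s))) ⟩
  R + suc (suc s * (9 * K) + suc (2 * suc K) + suc (suc (2 * R)))
    ≡⟨ solve 2 (λ s k → let r = con 2 :* (con 1 :+ k) in
         r :+ (con 1 :+ ((con 1 :+ s) :* (con 9 :* k) :+ (con 1 :+ con 2 :* (con 1 :+ k))
              :+ (con 2 :+ con 2 :* r)))
         := con 9 :* ((con 1 :+ s) :* k) :+ (con 8 :* (con 1 :* k) :+ con 12 :* (con 1 :* con 1))) refl s K ⟩
  9 * (suc s * K) + (8 * (1 * K) + 12 * (1 * 1))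
    ≤⟨ +-monoʳ-≤ (9 * (suc s * K)) (+-mono-≤ (*-monoʳ-≤ 8 (*-monoˡ-≤ K 1≤1+s))
         (*-monoʳ-≤ 12 (*-mono-≤ 1≤1+s (m^n>0 2 s)))) ⟩
  9 * (suc s * K) + (8 * (suc s * K) + 12 * (suc s * K))
    ≡⟨ solve 1 (λ x → con 9 :* x :+ (con 8 :* x :+ con 12 :* x) := con 29 :* x) refl (suc s * K) ⟩
  29 * (suc s * K) ∎
  where
  R = radius s
  K = 2 ^ s
  spreads = replicate (2 * R) spread
  1≤1+s : 1 ≤ suc s
  1≤1+s = s≤s z≤n

-- `suc s * 2 ^ s` at least doubles from stage to stage, so all stages together cost at most twice
-- the bound 29 for the last one.
clock-bound : ∀ {c n} (N : Network c n) s → Run.clock N (suc s) ≤ 58 * (suc s * 2 ^ s)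
clock-bound N zero    = ≤-trans (≤-reflexive (+-identityʳ (length (stage 0))))
                                (≤-trans (length-stage 0) (m≤m+n 29 29))
clock-bound N (suc s) = begin
  length (stage (suc s)) + Run.clock N (suc s)
    ≤⟨ +-mono-≤ (length-stage (suc s)) (clock-bound N s) ⟩
  29 * (suc (suc s) * 2 ^ suc s) + 58 * (suc s * 2 ^ s)
    ≤⟨ +-monoʳ-≤ (29 * (suc (suc s) * 2 ^ suc s)) (*-monoʳ-≤ 58 (*-monoˡ-≤ (2 ^ s) (n≤1+n (suc s)))) ⟩
  29 * (suc (suc s) * 2 ^ suc s) + 58 * (suc (suc s) * 2 ^ s)
    ≡⟨ solve 2 (λ s k → con 29 :* (s :* (con 2 :* k)) :+ con 58 :* (s :* k) := con 58 :* (s :* (con 2 :* k)))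
         refl (suc (suc s)) (2 ^ s) ⟩
  58 * (suc (suc s) * 2 ^ suc s) ∎

bracket : ∀ k → ∃ λ l → 2 ^ l ≤ suc k × suc k < 2 ^ suc l
bracket zero = 0 , ≤-refl , ≤-refl
bracket (suc k) with bracket k
... | l , low , high with suc (suc k) <? 2 ^ suc l
...   | yes high′ = l , m≤n⇒m≤1+n low , high′
...   | no ¬high′ = suc l , ≮⇒≥ ¬high′ , ≤-<-trans high (^-monoʳ-< 2 ≤-refl (n<1+n (suc l)))

-- For `opt` at least 2, `s` is one more than the rounded logarithm `l`, which is at least 1. Then
-- `s + 1` is at most `3 * l` and `2 ^ s` at most `2 * opt`, which gives the 6. For smaller `opt`
-- the logarithm vanishes and the added 1 pays.
successful-stage : ∀ opt → ∃ λ s → opt ≤ 2 ^ s × suc s * 2 ^ s ≤ 6 * (opt * ⌊log₂ opt ⌋ + 1)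
successful-stage 0             = 0 , z≤n , s≤s z≤n
successful-stage 1             = 0 , ≤-refl , s≤s z≤n
successful-stage opt@(suc (suc k)) with bracket (suc k)
... | zero  , low , s≤s (s≤s ())
... | suc l , low , high = suc (suc l) , <⇒≤ high , (begin
  suc (suc (suc l)) * 2 ^ suc (suc l)
    ≤⟨ *-monoˡ-≤ (2 ^ suc (suc l)) (≤-trans (m≤m+n (3 + l) (2 * l)) (≤-reflexive
         (solve 1 (λ l → con 3 :+ l :+ con 2 :* l := con 3 :* (con 1 :+ l)) refl l))) ⟩
  (3 * suc l) * (2 * 2 ^ suc l)
    ≡⟨ solve 2 (λ l k → (con 3 :* l) :* (con 2 :* k) := con 6 :* (k :* l)) refl (suc l) (2 ^ suc l) ⟩
  6 * (2 ^ suc l * suc l)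
    ≤⟨ *-monoʳ-≤ 6 (*-mono-≤ low (≤-trans (≤-reflexive (sym (⌊log₂[2^n]⌋≡n (suc l)))) (⌊log₂⌋-mono-≤ low))) ⟩
  6 * (opt * ⌊log₂ opt ⌋)
    ≤⟨ *-monoʳ-≤ 6 (m≤m+n (opt * ⌊log₂ opt ⌋) 1) ⟩
  6 * (opt * ⌊log₂ opt ⌋ + 1) ∎)

theorem1p1 : Σ Algorithm λ A → ∃ λ (C : ℕ) →
    ∀ (c : ℕ) → ∃ λ (B : ℕ) →
    ∀ {n : ℕ} (N : Network c n) → Bipartite (graph N) →
    MessagesWithin A N (logBits B n) ×
    (∃ λ (t : ℕ) → ∃ λ (S : Subset n) →
    HaltsWith A N t S ×
    IsMinimumVertexCover (graph N) S ×
    (let OPT = ∣ S ∣ in t ≤ C * (OPT * ⌊log₂ OPT ⌋ + 1)))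
-- 348 = 58 · 6, from the total over all stages and the rounding of OPT to a power of two.
theorem1p1 = algorithm , 348 , λ c → suc c , λ N bipartite → messages-short N , solves N bipartite
  where
  solves : ∀ {c n} (N : Network c n) → Bipartite (graph N) →
           ∃ λ (t : ℕ) → ∃ λ (S : Subset n) → HaltsWith algorithm N t S ×
           IsMinimumVertexCover (graph N) S × t ≤ 348 * (∣ S ∣ * ⌊log₂ ∣ S ∣ ⌋ + 1)
  solves N bipartite =
    let S₀ , min₀ = minimumVertexCover (graph N)
        s , opt≤ , bound = successful-stage ∣ S₀ ∣
        S , halted , min = Certificate.halts N s (Convergence.final-quiet N bipartite S₀ min₀ s opt≤)
        ∣S₀∣≡∣S∣ = ≤-antisym (proj₂ min₀ S (λ {u} {v} → proj₁ min {u} {v}))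
                             (proj₂ min S₀ (λ {u} {v} → proj₁ min₀ {u} {v}))
    in  Run.clock N (suc s) , S , halted , min ,
        subst (λ opt → Run.clock N (suc s) ≤ 348 * (opt * ⌊log₂ opt ⌋ + 1)) ∣S₀∣≡∣S∣
          (≤-trans (clock-bound N s) (≤-trans (*-monoʳ-≤ 58 bound)
            (≤-reflexive (sym (*-assoc 58 6 (∣ S₀ ∣ * ⌊log₂ ∣ S₀ ∣ ⌋ + 1))))))
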